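{- Consider an instance of the periodic lock scheduling problem with exactly two streams, one downstream with offset $\mu_D$ and periodicity $\lambda_D$ and one upstream with offset $\mu_U$ and periodicity $\lambda_U$, where $\lambda_D\ge 2$ and $\lambda_U\ge 2$. Let $\delta_1,\delta_2$ be the two directions labeled so that $\lambda_{\delta_1}\le\lambda_{\delta_2}$, and define the schedule $\sigma^*$ by, for every period $t$, $$\sigma^*(t)=\begin{cases}\delta_1 & \text{if } C_1(t),\\ \delta_2 & \text{otherwise, if } C_2(t)\text{ or } C_3(t)\text{ or } C_4(t),\\ W & \text{otherwise,}\end{cases}$$ where $C_1(t)$: $t\equiv\mu_{\delta_1}\pmod{\lambda_{\delta_1}}$ and not $t-1\equiv\mu_{\delta_1}\pmod{\lambda_{\delta_1}}$; $C_2(t)$: $t-1\equiv\mu_{\delta_1}\pmod{\lambda_{\delta_1}}$ and $t-1\equiv\mu_{\delta_2}\pmod{\lambda_{\delta_2}}$; $C_3(t)$: $t\not\equiv\mu_{\delta_1}\pmod{\lambda_{\delta_1}}$ and $t\equiv\mu_{\delta_2}\pmod{\lambda_{\delta_2}}$; $C_4(t)$: $t+1\equiv\mu_{\delta_1}\pmod{\lambda_{\delta_1}}$ and $\mu_{\delta_1}+\left\lfloor\frac{t-\mu_{\delta_1}}{\lambda_{\delta_1}}\right\rfloor\lambda_{\delta_1}>\mu_{\delta_2}+\left\lfloor\frac{t-\mu_{\delta_2}}{\lambda_{\delta_2}}\right\rfloor\lambda_{\delta_2}$. Then $\sigma^*$ is an optimal schedule. Furthermore, $\sigma^*(t)$ can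 be computed in time polynomial in the bit lengths of $t$ and of $(\mu_D,\mu_U,\lambda_D,\lambda_U)$.
   Context: Periodic lock scheduling problem. Time is discrete, periods $t=1,2,\dots$. There are $k$ vessel streams; stream $i$ has a direction $\delta_i\in\{D,U\}$ (downstream/upstream), an integer periodicity $\lambda_i\ge1$ and an integer offset $1\le\mu_i\le\lambda_i$. Let $I_\delta$ be the set of streams with direction $\delta$. Arrival patterns: $a_i(t)=1$ if $t\equiv\mu_i\pmod{\lambda_i}$ and $0$ otherwise; $a_\delta(t)=\sum_{i\in I_\delta}a_i(t)$ for $\delta\in\{D,U\}$; $a(t)=(a_D(t),a_U(t))$. Let $f(D)=U$, $f(U)=D$. A schedule is a sequence $\sigma=(\sigma(t))_{t\ge1}$ with $\sigma(t)\in\{D,U,W\}$: action $D$ processes the vessels waiting on the downstream side and switches the lock's alignment from downstream to upstream, $U$ symmetrically, and $W$ means the lock waits at its current alignment. The initial orientation of the lock is arbitrary. A schedule is feasible if the lock alternates: whenever $\sigma(t)\in\{D,U\}$, the most recent action before $t$ that is not $W$ (if any) is the other of $D,U$. Queue lengths: $n_D(0)=n_U(0)=0$ and, for $t\ge1$ and $\delta\in\{D,U\}$, $n_\delta(t)=0$ if $\sigma(t)=\delta$ and $n_\delta(t)=n_\delta(t-1)+a_\delta(t)$ otherwise. The waiting time in period $t$ is $C_\sigma(t)=n_D(t)+n_U(t)$ and the long-run average waiting time is $C_{\mathrm{avg},\sigma}=\lim_{T\to\infty}\frac1T\sum_{t=1}^T C_\sigma(t)$. A schedule is optimal if it is feasible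 and minimizes $C_{\mathrm{avg},\sigma}$ over all feasible schedules. In the schedule formula, the action "$\delta_1$" means processing the vessels of direction $\delta_1$ (action $D$ or $U$ accordingly). -}

module Defs where

open import Data.Bool using (if_then_else_)
open import Data.Fin using (Fin)
open import Data.Integer as ℤ using (ℤ; +_)
open import Data.Integer.Divisibility as ℤ using ()
open import Data.Integer.DivMod as ℤ using (_/ℕ_)
open import Data.List using (List; []; _∷_; map)
open import Data.Nat
open import Data.Nat.Divisibility using (_∣?_)
open import Data.Nat.ListAction using (sum)
open import Data.Nat.Logarithm using (⌊log₂_⌋)
open import Data.Product using (Σ-syntax; ∃; ∃-syntax; _×_; _,_; proj₁; proj₂)
open import Data.Rational.Unnormalised as ℚ using (ℚᵘ; 0ℚᵘ)
open import Data.Sum using (_⊎_)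
open import Data.Vec as Vec using (Vec; []; _∷_; _++_; head; lookup; replicate; _[_]≔_)
open import Relation.Binary.PropositionalEquality using (_≡_; refl)
open import Relation.Nullary using (Dec; yes; no; does; ¬_; ¬?; _×-dec_; _⊎-dec_)

data Direction : Set where
  D U : Direction

opposite : Direction → Direction
opposite D = U
opposite U = D

_≟ᴰ_ : (δ δ′ : Direction) → Dec (δ ≡ δ′)
D ≟ᴰ D = yes refl
D ≟ᴰ U = no λ ()
U ≟ᴰ D = no λ ()
U ≟ᴰ U = yes refl

_≡_[mod_] : ℤ → ℤ → ℕ → Set
i ≡ j [mod m ] = + m ℤ.∣ i ℤ.- j

_≡?_[mod_] : ∀ i j m → Dec (i ≡ j [mod m ])
i ≡? j [mod m ] = m ∣? ℤ.∣ i ℤ.- j ∣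

record Timing : Set where
  field
    period          : ℕ
    .{{period≢0}}   : NonZero period
    offset          : ℕ
    1≤offset        : 1 ≤ offset
    offset≤period   : offset ≤ period

  ArrivesAt : ℤ → Set
  ArrivesAt t = t ≡ + offset [mod period ]

  arrivesAt? : ∀ t → Dec (ArrivesAt t)
  arrivesAt? t = t ≡? + offset [mod period ]

  arrivals : ℕ → ℕ
  arrivals t = if does (arrivesAt? (+ t)) then 1 else 0

  -- _/ℕ_ rounds towards -∞, so for 1 ≤ t < offset this is offset - period.
  latest : ℤ → ℤ
  latest t = + offset ℤ.+ ((t ℤ.- + offset) /ℕ period) ℤ.* + period

open Timing public

Stream : Set
Stream = Direction × Timing

Instance : Set
Instance = List Stream

arrivalsFrom : Direction → Instance → ℕ → ℕ
arrivalsFrom δ I t =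
  sum (map (λ s → if does (proj₁ s ≟ᴰ δ) then arrivals (proj₂ s) t else 0) I)

data Action : Set where
  process : Direction → Action
  W       : Action

-- Periods are the t ≥ 1; no definition below depends on the value at 0.
Schedule : Set
Schedule = ℕ → Action

Feasible : Schedule → Set
Feasible σ = ∀ {s t δ δ′} → 1 ≤ s → s < t →
  σ s ≡ process δ → σ t ≡ process δ′ →
  (∀ r → s < r → r < t → σ r ≡ W) →
  δ ≡ opposite δ′

queueAfter : Action → Direction → ℕ → ℕ
queueAfter W            δ n = n
queueAfter (process δ′) δ n = if does (δ′ ≟ᴰ δ) then 0 else n

queue : Instance → Schedule → Direction → ℕ → ℕ
queue I σ δ zero    = 0
queue I σ δ (suc t) =
  queueAfter (σ (suc t)) δ (queue I σ δ t + arrivalsFrom δ I (suc t))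

waiting : Instance → Schedule → ℕ → ℕ
waiting I σ t = queue I σ D t + queue I σ U t

totalWaiting : Instance → Schedule → ℕ → ℕ
totalWaiting I σ zero    = 0
totalWaiting I σ (suc T) = totalWaiting I σ T + waiting I σ (suc T)

-- The average over periods 1, …, T, indexed by T - 1.
averageWaiting : Instance → Schedule → ℕ → ℚᵘ
averageWaiting I σ n = + totalWaiting I σ (suc n) ℚ./ suc n

record ℝ : Set where
  field
    approx : ℕ → ℚᵘ
    cauchy : ∀ ε → 0ℚᵘ ℚ.< ε → ∃[ N ] ∀ m n → N ≤ m → N ≤ n →
             ℚ.∣ approx m ℚ.- approx n ∣ ℚ.≤ ε

open ℝ public

_⟶_ : (ℕ → ℚᵘ) → ℝ → Set
x ⟶ L = ∀ ε → 0ℚᵘ ℚ.< ε → ∃[ N ] ∀ n → N ≤ n →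
        ℚ.∣ x n ℚ.- approx L n ∣ ℚ.≤ ε

_≤liminf_ : ℝ → (ℕ → ℚᵘ) → Set
L ≤liminf x = ∀ ε → 0ℚᵘ ℚ.< ε → ∃[ N ] ∀ n → N ≤ n →
              approx L n ℚ.≤ x n ℚ.+ ε

-- The averages of a competing feasible schedule need not converge.  Comparing
-- with their lower limit covers every feasible schedule; when they do converge
-- the lower limit is the long-run average.
record Optimal (I : Instance) (σ : Schedule) : Set where
  field
    feasible  : Feasible σ
    average   : ℝ
    converges : averageWaiting I σ ⟶ average
    minimal   : ∀ σ′ → Feasible σ′ → average ≤liminf averageWaiting I σ′

record TwoStreams : Set where
  field
    timing   : Direction → Timing
    2≤period : ∀ δ → 2 ≤ period (timing δ)

  streams : Instance
  streams = (D , timing D) ∷ (U , timing U) ∷ []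

open TwoStreams public

module Conditions (I : TwoStreams) (δ₁ : Direction) (n : ℕ) where

  private
    s₁ = timing I δ₁
    s₂ = timing I (opposite δ₁)
    t  = + n

  C₁ C₂ C₃ C₄ : Set
  C₁ = ArrivesAt s₁ t × ¬ ArrivesAt s₁ (t ℤ.- + 1)
  C₂ = ArrivesAt s₁ (t ℤ.- + 1) × ArrivesAt s₂ (t ℤ.- + 1)
  C₃ = ¬ ArrivesAt s₁ t × ArrivesAt s₂ t
  C₄ = ArrivesAt s₁ (t ℤ.+ + 1) × latest s₁ t ℤ.> latest s₂ t

  C₁? : Dec C₁
  C₁? = arrivesAt? s₁ t ×-dec ¬? (arrivesAt? s₁ (t ℤ.- + 1))

  C₂? : Dec C₂
  C₂? = arrivesAt? s₁ (t ℤ.- + 1) ×-dec arrivesAt? s₂ (t ℤ.- + 1)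

  C₃? : Dec C₃
  C₃? = ¬? (arrivesAt? s₁ t) ×-dec arrivesAt? s₂ t

  C₄? : Dec C₄
  C₄? = arrivesAt? s₁ (t ℤ.+ + 1) ×-dec (latest s₂ t ℤ.<? latest s₁ t)

σ* : TwoStreams → Direction → Schedule
σ* I δ₁ t =
  if does C₁? then process δ₁
  else if does (C₂? ⊎-dec C₃? ⊎-dec C₄?) then process (opposite δ₁)
  else W
  where open Conditions I δ₁ t

-- The direction with the smaller period; `tie` if the periods are equal.
shorter : Direction → TwoStreams → Direction
shorter tie I =
  if does (period (timing I tie) ≤? period (timing I (opposite tie)))
  then tie else opposite tie

bitLength : ℕ → ℕ
bitLength n = suc ⌊log₂ n ⌋

-- Programs for a random access machine with finitely many directly addressed
-- registers and logarithmic cost: an operation is charged the total bit length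
-- of its operands.  Addition, truncated subtraction and comparison are the only
-- arithmetic, so each operation takes linear time on a multitape Turing machine,
-- and the model has the same polynomial-time functions as Turing machines
-- (a tape is a pair of registers used as binary stacks).
data Expr (r : ℕ) : Set where
  const   : ℕ → Expr r
  reg     : Fin r → Expr r
  _⊕_ _⊖_ : Fin r → Fin r → Expr r

data Program (r : ℕ) : Set where
  _≔_     : Fin r → Expr r → Program r
  _⨾_     : Program r → Program r → Program r
  ifLE    : Fin r → Fin r → Program r → Program r → Program r
  whileLE : Fin r → Fin r → Program r → Program r

State : ℕ → Set
State = Vec ℕ

module _ {r : ℕ} where

  value : Expr r → State r → ℕ
  value (const n) s = n
  value (reg x)   s = lookup s x
  value (x ⊕ y)   s = lookup s x + lookup s y
  value (x ⊖ y)   s = lookup s x ∸ lookup s y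

  operandLength : Fin r → Fin r → State r → ℕ
  operandLength x y s = bitLength (lookup s x) + bitLength (lookup s y)

  exprCost : Expr r → State r → ℕ
  exprCost (const n) s = bitLength n
  exprCost (reg x)   s = bitLength (lookup s x)
  exprCost (x ⊕ y)   s = operandLength x y s
  exprCost (x ⊖ y)   s = operandLength x y s

  -- Run p s s′ c: started in s, p halts in s′ at cost c.
  data Run : Program r → State r → State r → ℕ → Set where
    assign : ∀ {x e s} →
      Run (x ≔ e) s (s [ x ]≔ value e s) (exprCost e s)
    seq : ∀ {p q s s′ s″ c d} →
      Run p s s′ c → Run q s′ s″ d → Run (p ⨾ q) s s″ (c + d)
    if-true : ∀ {x y p q s s′ c} → lookup s x ≤ lookup s y →
      Run p s s′ c →
      Run (ifLE x y p q) s s′ (operandLength x y s + c)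
    if-false : ∀ {x y p q s s′ c} → ¬ (lookup s x ≤ lookup s y) →
      Run q s s′ c →
      Run (ifLE x y p q) s s′ (operandLength x y s + c)
    while-true : ∀ {x y p s s′ s″ c d} → lookup s x ≤ lookup s y →
      Run p s s′ c → Run (whileLE x y p) s′ s″ d →
      Run (whileLE x y p) s s″ (operandLength x y s + c + d)
    while-false : ∀ {x y p s} → ¬ (lookup s x ≤ lookup s y) →
      Run (whileLE x y p) s s (operandLength x y s)

size : ∀ {k} → Vec ℕ k → ℕ
size v = Vec.sum (Vec.map bitLength v)

-- One program for all x : X.  It starts with `input x` in its first registers
-- and 0 in the others, and leaves `output x` in its first register.  Bit lengths
-- are positive, so a monomial bound is as general as a polynomial one.
PolynomialTime : {X : Set} {k : ℕ} → (X → Vec ℕ (suc k)) → (X → ℕ) → Set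
PolynomialTime {X} {k} input output =
  ∃[ m ] Σ[ p ∈ Program (suc k + m) ] ∃[ a ] ∃[ e ] ∀ (x : X) →
    ∃[ s ] ∃[ c ]
      Run p (input x ++ replicate m 0) s c ×
      head s ≡ output x ×
      c ≤ a * size (input x) ^ e

encodeAction : Action → ℕ
encodeAction W           = 0
encodeAction (process D) = 1
encodeAction (process U) = 2

Query : Set
Query = TwoStreams × ∃[ t ] 1 ≤ t

encodeQuery : Query → Vec ℕ 5
encodeQuery (I , t , _) =
  t ∷ offset (timing I D) ∷ offset (timing I U)
    ∷ period (timing I D) ∷ period (timing I U) ∷ []

σ*-at : Direction → Query → Action
σ*-at tie (I , t , _) = σ* I (shorter tie I) t

{-# OPTIONS --safe #-}
module Submission where

-- When both streams have an arrival in the same period, at most one of the two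
-- vessels is processed at once, so every schedule waits at least one unit in each
-- such period.  σ* waits exactly that much: vessels of the stream δ₁ never wait,
-- and between two consecutive arrivals of δ₁ the lock turns exactly once for δ₂,
-- at the arrival of a δ₂-vessel if there is one (delayed by one period after a
-- joint arrival) and just before the next arrival of δ₁ otherwise.  The waiting
-- time of σ* is periodic, so its averages converge.
--
-- The action of σ* depends only on the ages of the streams, that is, on the times
-- since their latest arrivals.  These are residues of t modulo the periods, and
-- subtracting maximal doublings of the modulus computes a residue in
-- quadratically many additions, subtractions and comparisons.

open import Defs
open import Data.Bool using (if_then_else_)
open import Data.Fin using (Fin; zero; suc; #_)
open import Data.Integer as ℤ using (ℤ; +_; _%ℕ_; _/ℕ_)
import Data.Integer.Divisibility.Signed as Signed
import Data.Integer.DivMod as ℤ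
import Data.Integer.Properties as ℤ
import Data.Integer.Tactic.RingSolver as ℤ-Solver
open import Data.Nat
open import Data.Nat.Divisibility using
  (_∣_; divides; >⇒∤; ∣⇒≤; _∣0; ∣-refl; ∣1⇒≡1; ∣m∣n⇒∣m+n)
open import Data.Nat.DivMod using
  (_%_; _/_; m%n<n; m≡m%n+[m/n]*n; m<n⇒m%n≡m; m*n≤o⇒[o∸m*n]%n≡o%n)
open import Data.Nat.Logarithm using (⌊log₂⌋-mono-≤; ⌊log₂[2^n]⌋≡n)
open import Data.Nat.Properties
import Data.Nat.Tactic.RingSolver as ℕ-Solver
open import Data.Product using (∃-syntax; _×_; _,_; proj₁)
open import Data.Rational.Unnormalised as ℚ using (mkℚᵘ; 0ℚᵘ; *≤*; *<*)
import Data.Rational.Unnormalised.Properties as ℚ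
open import Data.Sum using (_⊎_; inj₁; inj₂)
open import Data.Vec using (Vec; []; _∷_; head; lookup; _[_]≔_)
open import Function using (_∘_; _⇔_; mk⇔; Equivalence)
open import Relation.Binary.PropositionalEquality
open import Relation.Nullary

open Equivalence using (to; from)

-- Time since the latest arrival

∣∧<⇒≡0 : ∀ {m n} → m ∣ n → n < m → n ≡ 0
∣∧<⇒≡0 {n = zero}  _   _   = refl
∣∧<⇒≡0 {n = suc _} m∣n n<m = contradiction m∣n (>⇒∤ n<m)

-- The difference of the remainders is a multiple of `p`, and its absolute value is at most the
-- larger remainder, hence below `p`.
remainder-unique : ∀ {p r r′} (q q′ : ℤ) → r < p → r′ < p →
  + r ℤ.+ q ℤ.* + p ≡ + r′ ℤ.+ q′ ℤ.* + p → r ≡ r′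
remainder-unique {p} {r} {r′} q q′ r<p r′<p eq =
  ℤ.+-injective (ℤ.i-j≡0⇒i≡j (+ r) (+ r′) (ℤ.∣i∣≡0⇒i≡0 (∣∧<⇒≡0 p∣r-r′ r-r′<p)))
  where
  cancel : ∀ a b c d → a ℤ.- b ≡ (a ℤ.+ c) ℤ.- (b ℤ.+ d) ℤ.+ (d ℤ.- c)
  cancel = ℤ-Solver.solve-∀

  factor : ∀ a b c d → (a ℤ.- a) ℤ.+ (d ℤ.* b ℤ.- c ℤ.* b) ≡ (d ℤ.- c) ℤ.* b
  factor = ℤ-Solver.solve-∀

  difference : + r ℤ.- + r′ ≡ (q′ ℤ.- q) ℤ.* + p
  difference = begin
    + r ℤ.- + r′
      ≡⟨ cancel (+ r) (+ r′) (q ℤ.* + p) (q′ ℤ.* + p) ⟩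
    (+ r ℤ.+ q ℤ.* + p) ℤ.- (+ r′ ℤ.+ q′ ℤ.* + p) ℤ.+ (q′ ℤ.* + p ℤ.- q ℤ.* + p)
      ≡⟨ cong (λ x → x ℤ.- (+ r′ ℤ.+ q′ ℤ.* + p) ℤ.+ (q′ ℤ.* + p ℤ.- q ℤ.* + p)) eq ⟩
    (+ r′ ℤ.+ q′ ℤ.* + p) ℤ.- (+ r′ ℤ.+ q′ ℤ.* + p) ℤ.+ (q′ ℤ.* + p ℤ.- q ℤ.* + p)
      ≡⟨ factor (+ r′ ℤ.+ q′ ℤ.* + p) (+ p) q q′ ⟩
    (q′ ℤ.- q) ℤ.* + p ∎
    where open ≡-Reasoning

  p∣r-r′ : p ∣ ℤ.∣ + r ℤ.- + r′ ∣
  p∣r-r′ = Signed.∣⇒∣ᵤ (Signed.divides (q′ ℤ.- q) difference)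

  r-r′<p : ℤ.∣ + r ℤ.- + r′ ∣ < p
  r-r′<p = subst (λ i → ℤ.∣ i ∣ < p) (sym (ℤ.[+m]-[+n]≡m⊖n r r′))
             (≤-<-trans (ℤ.∣m⊝n∣≤m⊔n r r′) (⊔-pres-<m r<p r′<p))

-- The floored remainder extends the arrival pattern to periods before the offset, in agreement with
-- `latest`; there the latest arrival is a virtual one.
age : Timing → ℕ → ℕ
age s n = (+ n ℤ.- + offset s) %ℕ period s

module _ (s : Timing) where

  private
    p = period s
    o = offset s

    shift : ∀ a b c → (a ℤ.+ b) ℤ.- c ≡ a ℤ.+ (b ℤ.- c)
    shift = ℤ-Solver.solve-∀

    quotient : ℕ → ℤ
    quotient n = (+ n ℤ.- + o) /ℕ p

    age-spec : ∀ n → + n ℤ.- + o ≡ + age s n ℤ.+ quotient n ℤ.* + p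
    age-spec n = ℤ.a≡a%ℕn+[a/ℕn]*n (+ n ℤ.- + o) p

  age<period : ∀ n → age s n < p
  age<period n = ℤ.n%ℕd<d (+ n ℤ.- + o) p

  -- Reduces each computation of an age to exhibiting a quotient.
  age-unique : ∀ {n r} (q : ℤ) → r < p →
    + n ℤ.- + o ≡ + r ℤ.+ q ℤ.* + p → age s n ≡ r
  age-unique {n} q r<p eq =
    remainder-unique (quotient n) q (age<period n) r<p (trans (sym (age-spec n)) eq)

  age-suc : ∀ n → suc (age s n) < p → age s (suc n) ≡ suc (age s n)
  age-suc n lt = age-unique (quotient n) lt
    (trans (cong (λ x → x ℤ.- + o) (ℤ.pos-+ 1 n))
    (trans (shift (+ 1) (+ n) (+ o))
    (trans (cong (λ x → + 1 ℤ.+ x) (age-spec n))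
    (trans (sym (ℤ.+-assoc (+ 1) (+ age s n) (quotient n ℤ.* + p)))
           (cong (λ x → x ℤ.+ quotient n ℤ.* + p) (sym (ℤ.pos-+ 1 (age s n))))))))

  age-wrap : ∀ n → suc (age s n) ≡ p → age s (suc n) ≡ 0
  age-wrap n eq = age-unique (+ 1 ℤ.+ quotient n) (>-nonZero⁻¹ p)
    (trans (cong (λ x → x ℤ.- + o) (ℤ.pos-+ 1 n))
    (trans (shift (+ 1) (+ n) (+ o))
    (trans (cong (λ x → + 1 ℤ.+ x) (age-spec n))
    (trans (sym (ℤ.+-assoc (+ 1) (+ age s n) (quotient n ℤ.* + p)))
    (trans (cong (λ x → x ℤ.+ quotient n ℤ.* + p)
             (trans (sym (ℤ.pos-+ 1 (age s n))) (cong +_ eq)))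
           (collect (quotient n) (+ p)))))))
    where
    collect : ∀ q d → d ℤ.+ q ℤ.* d ≡ + 0 ℤ.+ (+ 1 ℤ.+ q) ℤ.* d
    collect = ℤ-Solver.solve-∀

  age-periodic : ∀ k n → age s (k * p + n) ≡ age s n
  age-periodic k n = age-unique (+ k ℤ.+ quotient n) (age<period n)
    (trans (cong (λ x → x ℤ.- + o) (trans (ℤ.pos-+ (k * p) n) (cong (λ x → x ℤ.+ + n) (ℤ.pos-* k p))))
    (trans (shift (+ k ℤ.* + p) (+ n) (+ o))
    (trans (cong (λ x → + k ℤ.* + p ℤ.+ x) (age-spec n))
           (collect (+ k) (+ p) (+ age s n) (quotient n)))))
    where
    collect : ∀ k d a q → k ℤ.* d ℤ.+ (a ℤ.+ q ℤ.* d) ≡ a ℤ.+ (k ℤ.+ q) ℤ.* d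
    collect = ℤ-Solver.solve-∀

  -- The form that the program evaluates. Since `o ≤ p`, adding `p` before subtracting `o` keeps
  -- truncated subtraction exact; the quotient drops by 1 in return.
  age-% : ∀ n → age s n ≡ (n + p ∸ o) % p
  age-% n = age-unique (+ (m / p) ℤ.- + 1) (m%n<n m p)
    (trans (complete (+ n) (+ o) (+ p))
    (trans (cong (λ x → x ℤ.- + p) +m)
           (collect (+ (m % p)) (+ (m / p)) (+ p))))
    where
    m = n + p ∸ o
    complete : ∀ a b c → a ℤ.- b ≡ ((a ℤ.+ c) ℤ.- b) ℤ.- c
    complete = ℤ-Solver.solve-∀
    collect : ∀ r q d → (r ℤ.+ q ℤ.* d) ℤ.- d ≡ r ℤ.+ (q ℤ.- + 1) ℤ.* d
    collect = ℤ-Solver.solve-∀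
    +m : (+ n ℤ.+ + p) ℤ.- + o ≡ + (m % p) ℤ.+ + (m / p) ℤ.* + p
    +m = begin
      (+ n ℤ.+ + p) ℤ.- + o                ≡⟨ cong (λ x → x ℤ.- + o) (sym (ℤ.pos-+ n p)) ⟩
      + (n + p) ℤ.- + o                    ≡⟨ ℤ.[+m]-[+n]≡m⊖n (n + p) o ⟩
      (n + p) ℤ.⊖ o                        ≡⟨ ℤ.⊖-≥ (m≤n⇒m≤o+n n (offset≤period s)) ⟩
      + m                                  ≡⟨ cong +_ (m≡m%n+[m/n]*n m p) ⟩
      + (m % p + m / p * p)                ≡⟨ ℤ.pos-+ (m % p) (m / p * p) ⟩
      + (m % p) ℤ.+ + (m / p * p)          ≡⟨ cong (λ x → + (m % p) ℤ.+ x) (ℤ.pos-* (m / p) p) ⟩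
      + (m % p) ℤ.+ + (m / p) ℤ.* + p      ∎
      where open ≡-Reasoning

  latest+age : ∀ n → latest s (+ n) ℤ.+ + age s n ≡ + n
  latest+age n = trans (rearrange (+ o) (quotient n ℤ.* + p) (+ age s n))
                 (trans (cong (λ x → + o ℤ.+ x) (sym (age-spec n))) (complete (+ n) (+ o)))
    where
    rearrange : ∀ a b c → (a ℤ.+ b) ℤ.+ c ≡ a ℤ.+ (c ℤ.+ b)
    rearrange = ℤ-Solver.solve-∀
    complete : ∀ a b → b ℤ.+ (a ℤ.- b) ≡ a
    complete = ℤ-Solver.solve-∀

  private
    -- Discarding a multiple of the period turns an arrival near `n` into a condition on the age
    -- alone. The conditions of σ* need `j` = 0, -1 and 1.
    arrives-near : ∀ n (j : ℤ) → ArrivesAt s (+ n ℤ.+ j) ⇔ p ∣ ℤ.∣ + age s n ℤ.+ j ∣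
    arrives-near n j = mk⇔
      (λ d → Signed.∣⇒∣ᵤ (Signed.∣m+n∣m⇒∣n {m = quotient n ℤ.* + p}
               (subst (+ p Signed.∣_) eq (Signed.∣ᵤ⇒∣ d)) multiple))
      (λ d → Signed.∣⇒∣ᵤ (subst (+ p Signed.∣_) (sym eq)
               (Signed.∣m∣n⇒∣m+n multiple (Signed.∣ᵤ⇒∣ d))))
      where
      multiple : + p Signed.∣ quotient n ℤ.* + p
      multiple = Signed.divides (quotient n) refl
      exchange : ∀ a b c → (a ℤ.+ b) ℤ.- c ≡ (a ℤ.- c) ℤ.+ b
      exchange = ℤ-Solver.solve-∀
      rearrange : ∀ a b c → (a ℤ.+ b) ℤ.+ c ≡ b ℤ.+ (a ℤ.+ c)
      rearrange = ℤ-Solver.solve-∀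
      eq : (+ n ℤ.+ j) ℤ.- + o ≡ quotient n ℤ.* + p ℤ.+ (+ age s n ℤ.+ j)
      eq = trans (exchange (+ n) j (+ o))
           (trans (cong (λ x → x ℤ.+ j) (age-spec n)) (rearrange (+ age s n) (quotient n ℤ.* + p) j))

  arrives⇔age≡0 : ∀ n → ArrivesAt s (+ n) ⇔ age s n ≡ 0
  arrives⇔age≡0 n = mk⇔
    (λ a → ∣∧<⇒≡0 (subst (λ x → p ∣ ℤ.∣ x ∣) (ℤ.+-identityʳ (+ age s n))
              (to (arrives-near n (+ 0)) (subst (ArrivesAt s) (sym (ℤ.+-identityʳ (+ n))) a)))
            (age<period n))
    (λ eq → subst (ArrivesAt s) (ℤ.+-identityʳ (+ n))
              (from (arrives-near n (+ 0)) (subst (λ a → p ∣ ℤ.∣ + a ℤ.+ + 0 ∣) (sym eq) (p ∣0))))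

  arrived⇔age≡1 : 2 ≤ p → ∀ n → ArrivesAt s (+ n ℤ.- + 1) ⇔ age s n ≡ 1
  arrived⇔age≡1 2≤p n = mk⇔
    (λ a → onlyIf (age s n) (age<period n) (to (arrives-near n (ℤ.- + 1)) a))
    (λ eq → from (arrives-near n (ℤ.- + 1))
              (subst (λ a → p ∣ ℤ.∣ + a ℤ.- + 1 ∣) (sym eq) (p ∣0)))
    where
    onlyIf : ∀ a → a < p → p ∣ ℤ.∣ + a ℤ.- + 1 ∣ → a ≡ 1
    -- At age 0 the absolute value is 1, and a period of at least 2 does not divide it.
    onlyIf zero    _   p∣1 = contradiction (∣1⇒≡1 p∣1) (>⇒≢ 2≤p)
    onlyIf (suc a) a<p p∣a = cong suc (∣∧<⇒≡0 p∣a (<-trans (n<1+n a) a<p))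

  arrives-next⇔age≡period-1 : ∀ n → ArrivesAt s (+ n ℤ.+ + 1) ⇔ suc (age s n) ≡ p
  arrives-next⇔age≡period-1 n = mk⇔
    (λ a → ≤-antisym (age<period n)
             (∣⇒≤ (subst (p ∣_) (+-comm (age s n) 1) (to (arrives-near n (+ 1)) a))))
    (λ eq → from (arrives-near n (+ 1))
              (subst (p ∣_) (trans (sym eq) (+-comm 1 (age s n))) ∣-refl))

-- For either stream the latest arrival and the age add up to `n`, so comparing arrivals reverses
-- the comparison of ages.
latest-order : ∀ s s′ n → (latest s (+ n) ℤ.< latest s′ (+ n)) ⇔ age s′ n < age s n
latest-order s s′ n = mk⇔
  (λ l → ≰⇒> λ a≤a′ → ℤ.<-irrefl balance (ℤ.+-mono-<-≤ l (ℤ.+≤+ a≤a′)))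
  (λ a′<a → ℤ.≰⇒> λ l′≤l → ℤ.<-irrefl (sym balance) (ℤ.+-mono-≤-< l′≤l (ℤ.+<+ a′<a)))
  where
  balance : latest s (+ n) ℤ.+ + age s n ≡ latest s′ (+ n) ℤ.+ + age s′ n
  balance = trans (latest+age s n) (sym (latest+age s′ n))

-- Feasibility and waiting times

data Step (p a : ℕ) : ℕ → Set where
  older : suc a < p → Step p a (suc a)
  wrap  : suc a ≡ p → Step p a 0

age-step : ∀ s n → Step (period s) (age s n) (age s (suc n))
age-step s n with m≤n⇒m<n∨m≡n (age<period s n)
... | inj₁ lt = subst (Step _ _) (sym (age-suc s n lt)) (older lt)
... | inj₂ eq = subst (Step _ _) (sym (age-wrap s n eq)) (wrap eq)

-- Indexed by the ages of the streams δ₁ and δ₂.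
data Decision (δ₁ : Direction) (λ₁ : ℕ) : ℕ → ℕ → Action → Set where
  first      : ∀ {b} → Decision δ₁ λ₁ 0 b (process δ₁)
  arrival    : ∀ {a} → Decision δ₁ λ₁ (suc a) 0 (process (opposite δ₁))
  joint      : Decision δ₁ λ₁ 1 1 (process (opposite δ₁))
  reposition : ∀ {a b} → suc (suc a) ≡ λ₁ → a < b →
               Decision δ₁ λ₁ (suc a) (suc b) (process (opposite δ₁))
  idle       : ∀ {a b} → ¬ (a ≡ 0 × b ≡ 0) → ¬ (suc (suc a) ≡ λ₁ × a < b) →
               Decision δ₁ λ₁ (suc a) (suc b) W

-- The direction to be processed next: it is δ₁ once δ₂ has been processed since
-- the latest arrival of stream δ₁.
data Next (δ₁ : Direction) (λ₁ : ℕ) : ℕ → ℕ → Direction → Set where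
  fresh    : ∀ {b} → Next δ₁ λ₁ 0 b (opposite δ₁)
  unserved : ∀ {a b} → a < b → suc a < λ₁ → Next δ₁ λ₁ a b (opposite δ₁)
  served   : ∀ {a b} → b ≤ suc a → Next δ₁ λ₁ (suc a) b δ₁
  last     : ∀ {a b} → suc (suc a) ≡ λ₁ → Next δ₁ λ₁ (suc a) b δ₁

opposite-involutive : ∀ δ → opposite (opposite δ) ≡ δ
opposite-involutive D = refl
opposite-involutive U = refl

-- Establishes the invariant `Next` right after an action. An `arrival` or `joint` action leaves
-- `b ≤ a`, hence `served`; a `reposition` happens just before the next arrival of δ₁, hence `last`.
decision⇒next : ∀ {δ₁ λ₁ a b δ} →
  Decision δ₁ λ₁ a b (process δ) → Next δ₁ λ₁ a b (opposite δ)
decision⇒next first = fresh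
decision⇒next {δ₁} arrival
  rewrite opposite-involutive δ₁ = served z≤n
decision⇒next {δ₁} joint
  rewrite opposite-involutive δ₁ = served ≤-refl
decision⇒next {δ₁} (reposition eq _)
  rewrite opposite-involutive δ₁ = last eq

module _ {δ₁ : Direction} {λ₁ λ₂ : ℕ} (2≤λ₁ : 2 ≤ λ₁) (λ₁≤λ₂ : λ₁ ≤ λ₂) where

  -- The core of feasibility: the invariant from one period excludes an action of the wrong
  -- direction in the next.
  next⇒decision : ∀ {a b a′ b′ δ δ′} → Step λ₁ a a′ → Step λ₂ b b′ →
    Next δ₁ λ₁ a b δ → Decision δ₁ λ₁ a′ b′ (process δ′) → δ ≡ δ′
  next⇒decision (wrap eq) _ fresh           first = contradiction eq (<⇒≢ 2≤λ₁)
  next⇒decision (wrap eq) _ (unserved _ lt) first = contradiction eq (<⇒≢ lt)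
  next⇒decision (wrap _)  _ (served _)      first = refl
  next⇒decision (wrap _)  _ (last _)        first = refl
  next⇒decision (older _) _ fresh           arrival          = refl
  next⇒decision (older _) _ fresh           joint            = refl
  next⇒decision (older _) _ fresh           (reposition _ _) = refl
  next⇒decision (older _) _ (unserved _ _)  arrival          = refl
  next⇒decision (older _) _ (unserved _ _)  joint            = refl
  next⇒decision (older _) _ (unserved _ _)  (reposition _ _) = refl
  -- The previous δ₂-vessel came no earlier than the latest δ₁-vessel. Another one before the next
  -- δ₁-vessel would fit a whole period of δ₂ strictly inside one of δ₁, against `λ₁≤λ₂`.
  next⇒decision (older lt) (wrap eq) (served b≤a) arrival =
    contradiction (≤-trans (≤-trans λ₁≤λ₂ (≤-reflexive (sym eq))) (s≤s b≤a)) (<⇒≱ lt)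
  next⇒decision (older _) (older _) (served b≤a) (reposition _ a<b) =
    contradiction b≤a (<⇒≱ a<b)
  next⇒decision (older lt) _ (last eq) _ = contradiction eq (<⇒≢ lt)

  -- Waiting preserves the invariant. While δ₂ is due, the two negations in `idle` say that the
  -- latest δ₂-arrival is strictly older and that the last period of the cycle is not yet reached.
  next-idle : ∀ {a b a′ b′ δ} → Step λ₁ a a′ → Step λ₂ b b′ →
    Next δ₁ λ₁ a b δ → Decision δ₁ λ₁ a′ b′ W → Next δ₁ λ₁ a′ b′ δ
  next-idle (older lt) (older _) fresh (idle ¬joint ¬reposition) =
    unserved (s≤s 0<b) (≤∧≢⇒< lt λ eq → ¬reposition (eq , 0<b))
    where 0<b = n≢0⇒n>0 λ b≡0 → ¬joint (refl , b≡0)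
  next-idle (older lt) (older _) (unserved a<b _) (idle _ ¬reposition) =
    unserved (s≤s a<b) (≤∧≢⇒< lt λ eq → ¬reposition (eq , a<b))
  next-idle (older _)  (older _) (served b≤a) (idle _ _) = served (s≤s b≤a)
  next-idle (older lt) (older _) (last eq)    (idle _ _) = contradiction eq (<⇒≢ lt)

-- The action of σ* as a function of the ages

if-does-elim : ∀ {a p q} {A : Set a} {P : Set p} (Q : A → Set q) {x y} (P? : Dec P) →
  (P → Q x) → (¬ P → Q y) → Q (if does P? then x else y)
if-does-elim Q (yes p) f g = f p
if-does-elim Q (no ¬p) f g = g ¬p

arrived : ℕ → ℕ
arrived zero    = 1
arrived (suc _) = 0

arrived≤1 : ∀ a → arrived a ≤ 1
arrived≤1 zero    = ≤-refl
arrived≤1 (suc _) = z≤n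

arrivals≡arrived : ∀ s n → arrivals s n ≡ arrived (age s n)
arrivals≡arrived s n = if-does-elim (_≡ arrived (age s n)) (arrivesAt? s (+ n))
  (λ a → sym (cong arrived (to (arrives⇔age≡0 s n) a)))
  (λ ¬a → sym (arrived-≢0 λ eq → ¬a (from (arrives⇔age≡0 s n) eq)))
  where
  arrived-≢0 : ∀ {a} → a ≢ 0 → arrived a ≡ 0
  arrived-≢0 {zero}  a≢0 = contradiction refl a≢0
  arrived-≢0 {suc _} _   = refl

decide-first : ∀ {δ₁ λ₁ a b} → a ≡ 0 → Decision δ₁ λ₁ a b (process δ₁)
decide-first refl = first

decide-second : ∀ {δ₁ λ₁ a b} → a ≢ 0 →
  (a ≡ 1 × b ≡ 1) ⊎ b ≡ 0 ⊎ (suc a ≡ λ₁ × a < b) →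
  Decision δ₁ λ₁ a b (process (opposite δ₁))
decide-second {a = zero}              a≢0 _ = contradiction refl a≢0
decide-second {a = suc _}             _   (inj₁ (refl , refl)) = joint
decide-second {a = suc _}             _   (inj₂ (inj₁ refl)) = arrival
decide-second {a = suc _} {b = suc _} _   (inj₂ (inj₂ (eq , s≤s a<b))) = reposition eq a<b

decide-idle : ∀ {δ₁ λ₁ a b} → a ≢ 0 →
  ¬ ((a ≡ 1 × b ≡ 1) ⊎ b ≡ 0 ⊎ (suc a ≡ λ₁ × a < b)) →
  Decision δ₁ λ₁ a b W
decide-idle {a = zero}              a≢0 _ = contradiction refl a≢0
decide-idle {a = suc _} {b = zero}  _   ¬second = contradiction (inj₂ (inj₁ refl)) ¬second
decide-idle {a = suc _} {b = suc _} _   ¬second = idle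
  (λ (a≡0 , b≡0) → ¬second (inj₁ (cong suc a≡0 , cong suc b≡0)))
  (λ (eq , a<b) → ¬second (inj₂ (inj₂ (eq , s≤s a<b))))

decision : ∀ I δ₁ n → let s₁ = timing I δ₁ in
  Decision δ₁ (period s₁) (age s₁ n) (age (timing I (opposite δ₁)) n) (σ* I δ₁ n)
decision I δ₁ n =
  if-does-elim (Decision δ₁ (period s₁) a b) C₁?
    (decide-first ∘ to (arrives⇔age≡0 s₁ n) ∘ proj₁)
    λ ¬c₁ → if-does-elim (Decision δ₁ (period s₁) a b) (C₂? ⊎-dec C₃? ⊎-dec C₄?)
      (decide-second (a≢0 ¬c₁) ∘ to (second (a≢0 ¬c₁)))
      (λ ¬c → decide-idle (a≢0 ¬c₁) (¬c ∘ from (second (a≢0 ¬c₁))))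
  where
  open Conditions I δ₁ n
  s₁ = timing I δ₁
  s₂ = timing I (opposite δ₁)
  a  = age s₁ n
  b  = age s₂ n

  -- Age 0 yields both halves of `C₁`, because an arrival one period earlier would force age 1.
  a≢0 : ¬ C₁ → a ≢ 0
  a≢0 ¬c₁ a≡0 = ¬c₁
    ( from (arrives⇔age≡0 s₁ n) a≡0
    , λ arr → contradiction (trans (sym a≡0) (to (arrived⇔age≡1 s₁ (2≤period I δ₁) n) arr)) λ ())

  Second : Set
  Second = (a ≡ 1 × b ≡ 1) ⊎ b ≡ 0 ⊎ (suc a ≡ period s₁ × a < b)

  second : a ≢ 0 → (C₂ ⊎ C₃ ⊎ C₄) ⇔ Second
  second a≢0 = mk⇔
    (λ where
      (inj₁ (arr₁ , arr₂)) → inj₁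
        ( to (arrived⇔age≡1 s₁ (2≤period I δ₁) n) arr₁
        , to (arrived⇔age≡1 s₂ (2≤period I (opposite δ₁)) n) arr₂)
      (inj₂ (inj₁ (_ , arr₂))) → inj₂ (inj₁ (to (arrives⇔age≡0 s₂ n) arr₂))
      (inj₂ (inj₂ (arr₁ , lt))) → inj₂ (inj₂
        (to (arrives-next⇔age≡period-1 s₁ n) arr₁ , to (latest-order s₂ s₁ n) lt)))
    (λ where
      (inj₁ (a≡1 , b≡1)) → inj₁
        ( from (arrived⇔age≡1 s₁ (2≤period I δ₁) n) a≡1
        , from (arrived⇔age≡1 s₂ (2≤period I (opposite δ₁)) n) b≡1)
      (inj₂ (inj₁ b≡0)) → inj₂ (inj₁
        (a≢0 ∘ to (arrives⇔age≡0 s₁ n) , from (arrives⇔age≡0 s₂ n) b≡0))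
      (inj₂ (inj₂ (eq , a<b))) → inj₂ (inj₂
        (from (arrives-next⇔age≡period-1 s₁ n) eq , from (latest-order s₂ s₁ n) a<b)))

-- Queue lengths under σ* and the lower bound for all schedules

queueAfter-process : ∀ δ n → queueAfter (process δ) δ n ≡ 0
queueAfter-process D n = refl
queueAfter-process U n = refl

queueAfter-opposite : ∀ δ n → queueAfter (process δ) (opposite δ) n ≡ n
queueAfter-opposite D n = refl
queueAfter-opposite U n = refl

queueAfter-zero : ∀ α δ → queueAfter α δ 0 ≡ 0
queueAfter-zero W           δ = refl
queueAfter-zero (process D) D = refl
queueAfter-zero (process D) U = refl
queueAfter-zero (process U) D = refl
queueAfter-zero (process U) U = refl

-- A δ₁-vessel arrives only at age 0, where the decision is `first`; otherwise nothing joins the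
-- empty queue.
first-queue-step : ∀ {δ₁ λ₁ a b α} → Decision δ₁ λ₁ a b α →
  queueAfter α δ₁ (arrived a) ≡ 0
first-queue-step {δ₁} first            = queueAfter-process δ₁ _
first-queue-step {δ₁} {α = α} arrival          = queueAfter-zero α δ₁
first-queue-step {δ₁} {α = α} joint            = queueAfter-zero α δ₁
first-queue-step {δ₁} {α = α} (reposition _ _) = queueAfter-zero α δ₁
first-queue-step              (idle _ _)       = refl

-- A δ₂-vessel is left over only by a joint arrival, and the decision `joint` clears it one period
-- later. The bound by the joint-arrival indicator is therefore inductive.
second-queue-step : ∀ {δ₁ λ₁ λ₂ a b a′ b′ α q} → 2 ≤ λ₁ →
  Step λ₁ a a′ → Step λ₂ b b′ → Decision δ₁ λ₁ a′ b′ α →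
  q ≤ arrived a ⊓ arrived b →
  queueAfter α (opposite δ₁) (q + arrived b′) ≤ arrived a′ ⊓ arrived b′
-- Since `2 ≤ λ₁`, δ₁ does not arrive in two consecutive periods; so when `first` occurs, the
-- previous period had no joint arrival and `q` is 0.
second-queue-step {a = zero} 2≤λ₁ (wrap eq) _ first _ = contradiction eq (<⇒≢ 2≤λ₁)
second-queue-step {δ₁} {a = suc _} {b′ = b′} {q = zero} _ (wrap _) _ first z≤n = begin
  queueAfter (process δ₁) (opposite δ₁) (arrived b′) ≡⟨ queueAfter-opposite δ₁ (arrived b′) ⟩
  arrived b′                                         ≤⟨ ⊓-glb (arrived≤1 b′) ≤-refl ⟩
  1 ⊓ arrived b′                                     ∎
  where open ≤-Reasoning
second-queue-step {δ₁} {q = q} 2≤λ₁ _ _ arrival q≤ =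
  ≤-trans (≤-reflexive (queueAfter-process (opposite δ₁) (q + 1))) z≤n
second-queue-step {δ₁} {q = q} 2≤λ₁ _ _ joint q≤ =
  ≤-reflexive (queueAfter-process (opposite δ₁) (q + 0))
second-queue-step {δ₁} {q = q} 2≤λ₁ _ _ (reposition _ _) q≤ =
  ≤-reflexive (queueAfter-process (opposite δ₁) (q + 0))
second-queue-step {a = zero} {b = zero} _ (older _) (older _) (idle ¬joint _) q≤ =
  contradiction (refl , refl) ¬joint
second-queue-step {a = zero} {b = suc _} {q = q} _ (older _) (older _) (idle _ _) q≤ =
  ≤-trans (≤-reflexive (+-identityʳ q)) q≤
second-queue-step {a = suc _} {b = _} {q = q} _ (older _) (older _) (idle _ _) q≤ =
  ≤-trans (≤-reflexive (+-identityʳ q)) q≤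

totalWaiting-mono : ∀ I σ σ′ → (∀ n → waiting I σ (suc n) ≤ waiting I σ′ (suc n)) →
  ∀ T → totalWaiting I σ T ≤ totalWaiting I σ′ T
totalWaiting-mono I σ σ′ le zero    = z≤n
totalWaiting-mono I σ σ′ le (suc T) = +-mono-≤ (totalWaiting-mono I σ σ′ le T) (le T)

queue-step : ∀ I σ δ n → queue (streams I) σ δ (suc n) ≡
  queueAfter (σ (suc n)) δ (queue (streams I) σ δ n + arrived (age (timing I δ) (suc n)))
queue-step I σ δ n = cong (λ a → queueAfter (σ (suc n)) δ (queue (streams I) σ δ n + a))
  (trans (arrivalsFrom-streams δ) (arrivals≡arrived (timing I δ) (suc n)))
  where
  arrivalsFrom-streams : ∀ δ → arrivalsFrom δ (streams I) (suc n) ≡ arrivals (timing I δ) (suc n)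
  arrivalsFrom-streams D = +-identityʳ _
  arrivalsFrom-streams U = +-identityʳ _

-- On the values 0 and 1 the minimum is the conjunction.
jointArrival : TwoStreams → ℕ → ℕ
jointArrival I n = arrived (age (timing I D) n) ⊓ arrived (age (timing I U) n)

jointArrival-sym : ∀ I δ n →
  jointArrival I n ≡ arrived (age (timing I δ) n) ⊓ arrived (age (timing I (opposite δ)) n)
jointArrival-sym I D n = refl
jointArrival-sym I U n = ⊓-comm (arrived (age (timing I D) n)) (arrived (age (timing I U) n))

-- No action processes both directions.
processing-leaves : ∀ α q r a b → a ⊓ b ≤ queueAfter α D (q + a) + queueAfter α U (r + b)
processing-leaves W           q r a b = ≤-trans (m⊓n≤m a b) (≤-trans (m≤n+m a q) (m≤m+n (q + a) (r + b)))
processing-leaves (process D) q r a b = ≤-trans (m⊓n≤n a b) (m≤n+m b r)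
processing-leaves (process U) q r a b = ≤-trans (m⊓n≤m a b) (≤-trans (m≤n+m a q) (m≤m+n (q + a) 0))

jointArrival≤waiting : ∀ I σ n → jointArrival I (suc n) ≤ waiting (streams I) σ (suc n)
jointArrival≤waiting I σ n = ≤-trans
  (processing-leaves (σ (suc n)) (queue (streams I) σ D n) (queue (streams I) σ U n)
    (arrived (age (timing I D) (suc n))) (arrived (age (timing I U) (suc n))))
  (≤-reflexive (sym (cong₂ _+_ (queue-step I σ D n) (queue-step I σ U n))))

module _ (I : TwoStreams) (δ₁ : Direction)
         (λ₁≤λ₂ : period (timing I δ₁) ≤ period (timing I (opposite δ₁))) where

  private
    s₁ = timing I δ₁
    s₂ = timing I (opposite δ₁)
    λ₁ = period s₁
    λ₂ = period s₂
    σ = σ* I δ₁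

    2≤λ₁ = 2≤period I δ₁

  σ*-feasible : Feasible σ
  σ*-feasible {s} {t} {δ} {δ′} _ s<t σs σt idle-between =
    trans (sym (opposite-involutive δ)) (cong opposite (reach s<t σt idle-between))
    where
    decision-at : ∀ {n α} → σ n ≡ α → Decision δ₁ λ₁ (age s₁ n) (age s₂ n) α
    decision-at {n} eq = subst (Decision δ₁ λ₁ (age s₁ n) (age s₂ n)) eq (decision I δ₁ n)

    -- Induction from the action at `s`, which sets up the invariant, through the idle periods after
    -- it.
    next-at : ∀ n → s ≤ n → (∀ r → s < r → r ≤ n → σ r ≡ W) →
              Next δ₁ λ₁ (age s₁ n) (age s₂ n) (opposite δ)
    next-at n s≤n idle≤n with m≤n⇒m<n∨m≡n s≤n
    next-at n       _   _      | inj₂ refl = decision⇒next (decision-at σs)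
    next-at (suc n) s≤n idle≤n | inj₁ s<n  =
      next-idle 2≤λ₁ λ₁≤λ₂ (age-step s₁ n) (age-step s₂ n)
        (next-at n (s≤s⁻¹ s<n) λ r s<r r≤n → idle≤n r s<r (m≤n⇒m≤1+n r≤n))
        (decision-at (idle≤n (suc n) s<n ≤-refl))

    reach : ∀ {t} → s < t → σ t ≡ process δ′ → (∀ r → s < r → r < t → σ r ≡ W) →
            opposite δ ≡ δ′
    reach {suc t} (s≤s s≤t) σt idle-between =
      next⇒decision 2≤λ₁ λ₁≤λ₂ (age-step s₁ t) (age-step s₂ t)
        (next-at t s≤t λ r s<r r≤t → idle-between r s<r (s≤s r≤t))
        (decision-at σt)

  σ*-queue-first : ∀ n → queue (streams I) σ δ₁ n ≡ 0
  σ*-queue-first zero    = refl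
  σ*-queue-first (suc n) = trans (queue-step I σ δ₁ n)
    (trans (cong (λ q → queueAfter (σ (suc n)) δ₁ (q + arrived (age s₁ (suc n)))) (σ*-queue-first n))
           (first-queue-step (decision I δ₁ (suc n))))

  -- Only an inequality, because at 0 the queue is empty while `jointArrival` is 1 if both offsets
  -- equal their periods.
  σ*-queue-second : ∀ n → queue (streams I) σ (opposite δ₁) n ≤ jointArrival I n
  σ*-queue-second zero    = z≤n
  σ*-queue-second (suc n) = begin
    queue (streams I) σ (opposite δ₁) (suc n)           ≡⟨ queue-step I σ (opposite δ₁) n ⟩
    _                                                   ≤⟨ second-queue-step 2≤λ₁
                                                             (age-step s₁ n) (age-step s₂ n)
                                                             (decision I δ₁ (suc n)) previous ⟩
    arrived (age s₁ (suc n)) ⊓ arrived (age s₂ (suc n)) ≡⟨ jointArrival-sym I δ₁ (suc n) ⟨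
    jointArrival I (suc n)                              ∎
    where
    open ≤-Reasoning
    previous : queue (streams I) σ (opposite δ₁) n ≤ arrived (age s₁ n) ⊓ arrived (age s₂ n)
    previous = ≤-trans (σ*-queue-second n) (≤-reflexive (jointArrival-sym I δ₁ n))

  waiting-sym : ∀ σ δ n → waiting (streams I) σ n ≡
    queue (streams I) σ δ n + queue (streams I) σ (opposite δ) n
  waiting-sym σ D n = refl
  waiting-sym σ U n = +-comm (queue (streams I) σ D n) (queue (streams I) σ U n)

  σ*-waiting : ∀ n → waiting (streams I) σ (suc n) ≡ jointArrival I (suc n)
  σ*-waiting n = ≤-antisym upper (jointArrival≤waiting I σ n)
    where
    upper : waiting (streams I) σ (suc n) ≤ jointArrival I (suc n)
    upper = ≤-trans (≤-reflexive (waiting-sym σ δ₁ (suc n)))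
      (+-mono-≤ (≤-reflexive (σ*-queue-first (suc n))) (σ*-queue-second (suc n)))

  σ*-least-waiting : ∀ σ′ T → totalWaiting (streams I) σ T ≤ totalWaiting (streams I) σ′ T
  σ*-least-waiting σ′ = totalWaiting-mono (streams I) σ σ′ λ n →
    ≤-trans (≤-reflexive (σ*-waiting n)) (jointArrival≤waiting I σ′ n)

  σ*-waiting≤1 : ∀ n → waiting (streams I) σ (suc n) ≤ 1
  σ*-waiting≤1 n = ≤-trans (≤-reflexive (σ*-waiting n))
    (≤-trans (m⊓n≤m _ (arrived (age (timing I U) (suc n)))) (arrived≤1 (age (timing I D) (suc n))))

  -- The product of the periods is a multiple of both, so it fixes both ages and with them the joint
  -- arrivals.
  σ*-waiting-periodic : ∀ n → waiting (streams I) σ (λ₁ * λ₂ + suc n) ≡ waiting (streams I) σ (suc n)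
  σ*-waiting-periodic n = begin
    waiting (streams I) σ (λ₁ * λ₂ + suc n) ≡⟨ cong (waiting (streams I) σ) (+-suc (λ₁ * λ₂) n) ⟩
    waiting (streams I) σ (suc (λ₁ * λ₂ + n)) ≡⟨ σ*-waiting (λ₁ * λ₂ + n) ⟩
    jointArrival I (suc (λ₁ * λ₂ + n)) ≡⟨ jointArrival-sym I δ₁ _ ⟩
    arrived (age s₁ (suc (λ₁ * λ₂ + n))) ⊓ arrived (age s₂ (suc (λ₁ * λ₂ + n)))
      ≡⟨ cong₂ (λ a b → arrived a ⊓ arrived b)
           (trans (cong (age s₁) (trans (sym (+-suc (λ₁ * λ₂) n)) (cong (_+ suc n) (*-comm λ₁ λ₂))))
                  (age-periodic s₁ λ₂ (suc n)))
           (trans (cong (age s₂) (sym (+-suc (λ₁ * λ₂) n))) (age-periodic s₂ λ₁ (suc n))) ⟩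
    arrived (age s₁ (suc n)) ⊓ arrived (age s₂ (suc n)) ≡⟨ jointArrival-sym I δ₁ _ ⟨
    jointArrival I (suc n) ≡⟨ σ*-waiting n ⟨
    waiting (streams I) σ (suc n) ∎
    where open ≡-Reasoning

-- Convergence of the averages of periodic waiting times

∣⊖∣≤ : ∀ {m n k} → m ≤ n + k → n ≤ m + k → ℤ.∣ m ℤ.⊖ n ∣ ≤ k
∣⊖∣≤ {m} {n} {k} m≤n+k n≤m+k with ≤-total m n
... | inj₁ m≤n = ≤-trans (≤-reflexive (ℤ.∣⊖∣-≤ m≤n)) (m≤n+o⇒m∸n≤o n m n≤m+k)
... | inj₂ n≤m = ≤-trans (≤-reflexive (trans (ℤ.∣m⊖n∣≡∣n⊖m∣ m n) (ℤ.∣⊖∣-≤ n≤m)))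
                         (m≤n+o⇒m∸n≤o m n m≤n+k)

-- Moves the Cauchy estimate to natural numbers: `k` bounds the cross-multiplied difference of the
-- two fractions. `mkℚᵘ` stores the denominator minus 1.
ratio-distance≤ : ∀ {x y m n a b k} →
  suc n * x ≤ suc m * y + k → suc m * y ≤ suc n * x + k →
  k * suc b ≤ suc a * (suc m * suc n) →
  ℚ.∣ mkℚᵘ (+ x) m ℚ.- mkℚᵘ (+ y) n ∣ ℚ.≤ mkℚᵘ (+ suc a) b
ratio-distance≤ {x} {y} {m} {n} {a} {b} {k} x≤y+k y≤x+k k≤ =
  *≤* (subst₂ ℤ._≤_ (ℤ.pos-* ℤ.∣ i ∣ (suc b)) (ℤ.pos-* (suc a) (suc m * suc n))
        (ℤ.+≤+ (≤-trans (*-monoˡ-≤ (suc b) ∣i∣≤k) k≤)))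
  where
  i = + x ℤ.* + suc n ℤ.+ (ℤ.- + y) ℤ.* + suc m

  numerator : i ≡ (suc n * x) ℤ.⊖ (suc m * y)
  numerator = trans
    (cong₂ ℤ._+_ (trans (sym (ℤ.pos-* x (suc n))) (cong +_ (*-comm x (suc n))))
      (trans (sym (ℤ.neg-distribˡ-* (+ y) (+ suc m)))
        (cong ℤ.-_ (trans (sym (ℤ.pos-* y (suc m))) (cong +_ (*-comm y (suc m)))))))
    (ℤ.[+m]-[+n]≡m⊖n (suc n * x) (suc m * y))

  ∣i∣≤k : ℤ.∣ i ∣ ≤ k
  ∣i∣≤k = subst (λ j → ℤ.∣ j ∣ ≤ k) (sym numerator) (∣⊖∣≤ x≤y+k y≤x+k)

module PeriodicAverage
  (I : Instance) (σ : Schedule) (p : ℕ) .{{_ : NonZero p}}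
  (bounded  : ∀ n → waiting I σ (suc n) ≤ 1)
  (periodic : ∀ n → waiting I σ (p + suc n) ≡ waiting I σ (suc n))
  where

  private
    S = totalWaiting I σ

  total≤ : ∀ n → S n ≤ n
  total≤ zero    = z≤n
  total≤ (suc n) = ≤-trans (+-mono-≤ (total≤ n) (bounded n)) (≤-reflexive (+-comm n 1))

  total-period : ∀ n → S (p + n) ≡ S p + S n
  total-period zero    = trans (cong S (+-identityʳ p)) (sym (+-identityʳ (S p)))
  total-period (suc n) = begin
    S (p + suc n)                              ≡⟨ cong S (+-suc p n) ⟩
    S (p + n) + waiting I σ (suc (p + n))      ≡⟨ cong₂ _+_ (total-period n)
                                                    (trans (cong (waiting I σ) (sym (+-suc p n))) (periodic n)) ⟩
    S p + S n + waiting I σ (suc n)            ≡⟨ +-assoc (S p) (S n) _ ⟩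
    S p + S (suc n)                            ∎
    where open ≡-Reasoning

  total-periods : ∀ k n → S (k * p + n) ≡ k * S p + S n
  total-periods zero    n = refl
  total-periods (suc k) n = begin
    S (p + k * p + n)       ≡⟨ cong S (+-assoc p (k * p) n) ⟩
    S (p + (k * p + n))     ≡⟨ total-period (k * p + n) ⟩
    S p + S (k * p + n)     ≡⟨ cong (λ s → S p + s) (total-periods k n) ⟩
    S p + (k * S p + S n)   ≡⟨ +-assoc (S p) (k * S p) (S n) ⟨
    S p + k * S p + S n     ∎
    where open ≡-Reasoning

  private
    split : ∀ n → n ≡ n / p * p + n % p
    split n = trans (m≡m%n+[m/n]*n n p) (+-comm (n % p) _)

    residual≤ : ∀ n → S (n % p) ≤ p
    residual≤ n = ≤-trans (total≤ (n % p)) (<⇒≤ (m%n<n n p))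

    split-total : ∀ n → S n ≡ n / p * S p + S (n % p)
    split-total n = trans (cong S (split n)) (total-periods (n / p) (n % p))

  -- With `n = k * p + r`, the quantities `p * S n` and `n * S p` share the term `k * p * S p`. What
  -- remains is `p * S r` and `r * S p`, each at most `p * p`. The converse bound `density≤total`
  -- uses the same splitting.
  total≤density : ∀ n → p * S n ≤ n * S p + p * p
  total≤density n = begin
    p * S n                                ≡⟨ cong (λ s → p * s) (split-total n) ⟩
    p * (n / p * S p + S (n % p))          ≡⟨ expand p (n / p) (S p) (S (n % p)) ⟩
    n / p * p * S p + p * S (n % p)        ≤⟨ +-mono-≤ (*-monoˡ-≤ (S p) (≤-trans (m≤m+n _ (n % p)) (≤-reflexive (sym (split n)))))
                                                       (*-monoʳ-≤ p (residual≤ n)) ⟩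
    n * S p + p * p                        ∎
    where
    open ≤-Reasoning
    expand : ∀ p k s r → p * (k * s + r) ≡ k * p * s + p * r
    expand = ℕ-Solver.solve-∀

  density≤total : ∀ n → n * S p ≤ p * S n + p * p
  density≤total n = begin
    n * S p                              ≡⟨ cong (λ k → k * S p) (split n) ⟩
    (n / p * p + n % p) * S p            ≡⟨ expand p (n / p) (S p) (n % p) ⟩
    p * (n / p * S p) + n % p * S p      ≤⟨ +-mono-≤ (*-monoʳ-≤ p (≤-trans (m≤m+n _ (S (n % p))) (≤-reflexive (sym (split-total n)))))
                                                     (*-mono-≤ (<⇒≤ (m%n<n n p)) (total≤ p)) ⟩
    p * S n + p * p                      ∎
    where
    open ≤-Reasoning
    expand : ∀ p k s r → (k * p + r) * s ≡ p * (k * s) + r * s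
    expand = ℕ-Solver.solve-∀

  -- Both averages are compared with the density `S p / p`; multiplying by `p` avoids the division.
  total-cross : ∀ m n → n * S m ≤ m * S n + (m + n) * p
  total-cross m n = *-cancelˡ-≤ p (begin
    p * (n * S m)                      ≡⟨ e₁ p n (S m) ⟩
    n * (p * S m)                      ≤⟨ *-monoʳ-≤ n (total≤density m) ⟩
    n * (m * S p + p * p)              ≡⟨ e₂ n m (S p) p ⟩
    m * (n * S p) + n * (p * p)        ≤⟨ +-monoˡ-≤ (n * (p * p)) (*-monoʳ-≤ m (density≤total n)) ⟩
    m * (p * S n + p * p) + n * (p * p) ≡⟨ e₃ m n p (S n) ⟩
    p * (m * S n + (m + n) * p)        ∎)
    where
    open ≤-Reasoning
    e₁ : ∀ p n s → p * (n * s) ≡ n * (p * s)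
    e₁ = ℕ-Solver.solve-∀
    e₂ : ∀ n m s p → n * (m * s + p * p) ≡ m * (n * s) + n * (p * p)
    e₂ = ℕ-Solver.solve-∀
    e₃ : ∀ m n p s → m * (p * s + p * p) + n * (p * p) ≡ p * (m * s + (m + n) * p)
    e₃ = ℕ-Solver.solve-∀

  average-cauchy : ∀ ε → 0ℚᵘ ℚ.< ε → ∃[ N ] ∀ m n → N ≤ m → N ≤ n →
    ℚ.∣ averageWaiting I σ m ℚ.- averageWaiting I σ n ∣ ℚ.≤ ε
  average-cauchy (mkℚᵘ (+ zero) b) (*<* (ℤ.+<+ ()))
  -- Averages over at least `N` periods differ by at most `2 * p / N`, which this `N` makes
  -- `1 / suc b`, at most ε.
  average-cauchy (mkℚᵘ (+ suc a) b) _ = 2 * p * suc b , λ m n N≤m N≤n →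
    ratio-distance≤ {S (suc m)} {S (suc n)} {m} {n} {a} {b} (total-cross (suc m) (suc n))
      (≤-trans (total-cross (suc n) (suc m))
        (≤-reflexive (cong (λ k → suc n * S (suc m) + k * p) (+-comm (suc n) (suc m)))))
      (close {suc m} {suc n} (m≤n⇒m≤1+n N≤m) (m≤n⇒m≤1+n N≤n))
    where
    close : ∀ {m n} → 2 * p * suc b ≤ m → 2 * p * suc b ≤ n → (m + n) * p * suc b ≤ suc a * (m * n)
    close {m} {n} N≤m N≤n = *-cancelˡ-≤ 2 (begin
      2 * ((m + n) * p * suc b)              ≡⟨ e₁ m n p (suc b) ⟩
      m * (2 * p * suc b) + n * (2 * p * suc b) ≤⟨ +-mono-≤ (*-monoʳ-≤ m N≤n) (*-monoʳ-≤ n N≤m) ⟩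
      m * n + n * m                          ≡⟨ e₂ m n ⟩
      2 * (m * n)                            ≤⟨ *-monoʳ-≤ 2 (m≤m+n (m * n) (a * (m * n))) ⟩
      2 * (suc a * (m * n))                  ∎)
      where
      open ≤-Reasoning
      e₁ : ∀ m n p b → 2 * ((m + n) * p * b) ≡ m * (2 * p * b) + n * (2 * p * b)
      e₁ = ℕ-Solver.solve-∀
      e₂ : ∀ m n → m * n + n * m ≡ 2 * (m * n)
      e₂ = ℕ-Solver.solve-∀

averageWaiting-mono : ∀ I σ σ′ → (∀ T → totalWaiting I σ T ≤ totalWaiting I σ′ T) →
  ∀ n → averageWaiting I σ n ℚ.≤ averageWaiting I σ′ n
averageWaiting-mono I σ σ′ le n = *≤* (ℤ.*-monoʳ-≤-nonNeg (+ suc n) (ℤ.+≤+ (le (suc n))))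

σ*-optimal : (I : TwoStreams) (δ₁ : Direction) →
  period (timing I δ₁) ≤ period (timing I (opposite δ₁)) →
  Optimal (streams I) (σ* I δ₁)
σ*-optimal I δ₁ λ₁≤λ₂ = record
  { feasible  = σ*-feasible I δ₁ λ₁≤λ₂
  -- The limit is represented by the sequence of averages itself. Hence convergence is immediate,
  -- and minimality is a termwise comparison of averages.
  ; average   = record { approx = average ; cauchy = average-cauchy }
  ; converges = λ ε 0<ε → 0 , λ n _ → ℚ.≤-trans
      (ℚ.≤-reflexive (ℚ.∣-∣-cong (ℚ.+-inverseʳ (average n)))) (ℚ.<⇒≤ 0<ε)
  ; minimal   = λ σ′ _ ε 0<ε → 0 , λ n _ → ℚ.≤-trans
      (averageWaiting-mono (streams I) (σ* I δ₁) σ′ (σ*-least-waiting I δ₁ λ₁≤λ₂ σ′) n)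
      (ℚ.p≤p+q (averageWaiting (streams I) σ′ n) ε {{ℚ.nonNegative (ℚ.<⇒≤ 0<ε)}})
  }
  where
  average = averageWaiting (streams I) (σ* I δ₁)
  open PeriodicAverage (streams I) (σ* I δ₁)
    (period (timing I δ₁) * period (timing I (opposite δ₁)))
    {{m*n≢0 (period (timing I δ₁)) (period (timing I (opposite δ₁)))
        {{>-nonZero (<⇒≤ (2≤period I δ₁))}} {{>-nonZero (<⇒≤ (2≤period I (opposite δ₁)))}}}}
    (σ*-waiting≤1 I δ₁ λ₁≤λ₂) (σ*-waiting-periodic I δ₁ λ₁≤λ₂)

-- Polynomial time

n<2^bitLength : ∀ n → n < 2 ^ bitLength n
n<2^bitLength n = ≰⇒> λ 2^≤n → 1+n≰n
  (≤-trans (≤-reflexive (sym (⌊log₂[2^n]⌋≡n (bitLength n)))) (⌊log₂⌋-mono-≤ 2^≤n))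

bitLength≤ : ∀ {n} l → n < 2 ^ l → bitLength n ≤ suc l
bitLength≤ l n<2^l =
  s≤s (≤-trans (⌊log₂⌋-mono-≤ (<⇒≤ n<2^l)) (≤-reflexive (⌊log₂[2^n]⌋≡n l)))

-- Counting operations on small operands

module Bounded (l : ℕ) where

  Small : ℕ → Set
  Small n = n < 2 ^ l

  module _ {r : ℕ} where

    SmallOperands : Expr r → State r → Set
    SmallOperands (const n) s = Small n
    SmallOperands (reg x)   s = Small (lookup s x)
    SmallOperands (x ⊕ y)   s = Small (lookup s x) × Small (lookup s y)
    SmallOperands (x ⊖ y)   s = Small (lookup s x) × Small (lookup s y)

    -- Every operation on operands below 2 ^ l costs at most suc l + suc l, so it
    -- is enough to count the operations.
    record Within (p : Program r) (s s′ : State r) (n : ℕ) : Set where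
      constructor within
      field
        {cost} : ℕ
        run    : Run p s s′ cost
        cost≤  : cost ≤ n * (suc l + suc l)

    exprCost≤ : ∀ e {s} → SmallOperands e s → exprCost e s ≤ suc l + suc l
    exprCost≤ (const n) a       = m≤n⇒m≤n+o (suc l) (bitLength≤ l a)
    exprCost≤ (reg x)   a       = m≤n⇒m≤n+o (suc l) (bitLength≤ l a)
    exprCost≤ (x ⊕ y)   (a , b) = +-mono-≤ (bitLength≤ l a) (bitLength≤ l b)
    exprCost≤ (x ⊖ y)   (a , b) = +-mono-≤ (bitLength≤ l a) (bitLength≤ l b)

    step : ∀ {x e s} → SmallOperands e s → Within (x ≔ e) s (s [ x ]≔ value e s) 1
    step {e = e} a = within assign (≤-trans (exprCost≤ e a) (m≤m+n _ 0))

    infixr 5 _then_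
    _then_ : ∀ {p q s s′ s″ m n} → Within p s s′ m → Within q s′ s″ n →
             Within (p ⨾ q) s s″ (m + n)
    _then_ {m = m} {n} (within run c≤) (within run′ d≤) =
      within (seq run run′)
        (≤-trans (+-mono-≤ c≤ d≤) (≤-reflexive (sym (*-distribʳ-+ (suc l + suc l) m n))))

    private
      test≤ : ∀ x y (s : State r) → SmallOperands (x ⊕ y) s → operandLength x y s ≤ suc l + suc l
      test≤ x y s = exprCost≤ (x ⊕ y) {s}

    if-true≤ : ∀ {x y p q s s′ n} → SmallOperands (x ⊕ y) s → lookup s x ≤ lookup s y →
               Within p s s′ n → Within (ifLE x y p q) s s′ (suc n)
    if-true≤ {x} {y} {s = s} a x≤y (within run c≤) = within (if-true x≤y run) (+-mono-≤ (test≤ x y s a) c≤)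

    if-false≤ : ∀ {x y p q s s′ n} → SmallOperands (x ⊕ y) s → ¬ (lookup s x ≤ lookup s y) →
                Within q s s′ n → Within (ifLE x y p q) s s′ (suc n)
    if-false≤ {x} {y} {s = s} a x≰y (within run c≤) = within (if-false x≰y run) (+-mono-≤ (test≤ x y s a) c≤)

    while-true≤ : ∀ {x y p s s′ s″ m n} → SmallOperands (x ⊕ y) s → lookup s x ≤ lookup s y →
                  Within p s s′ m → Within (whileLE x y p) s′ s″ n →
                  Within (whileLE x y p) s s″ (suc m + n)
    while-true≤ {x} {y} {s = s} {m = m} {n} a x≤y (within run c≤) (within run′ d≤) =
      within (while-true x≤y run run′)
      (≤-trans (+-mono-≤ (+-mono-≤ (test≤ x y s a) c≤) d≤)
              (≤-reflexive (sym (*-distribʳ-+ (suc l + suc l) (suc m) n))))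

    while-false≤ : ∀ {x y p s} → SmallOperands (x ⊕ y) s → ¬ (lookup s x ≤ lookup s y) →
                   Within (whileLE x y p) s s 1
    while-false≤ {x} {y} {s = s} a x≰y = within (while-false x≰y) (≤-trans (test≤ x y s a) (m≤m+n _ 0))

    weaken : ∀ {p s s′ m n} → m ≤ n → Within p s s′ m → Within p s s′ n
    weaken m≤n (within run c≤) = within run (≤-trans c≤ (*-monoˡ-≤ (suc l + suc l) m≤n))

-- Besides the input, a state holds a number x, which is reduced modulo m by means
-- of a multiple d of m and its double e, and the age a of the first stream.
pattern ⟪_,_,_,_,_,_,_,_,_,_⟫ t o₁ o₂ p₁ p₂ x m d e a =
  t ∷ o₁ ∷ o₂ ∷ p₁ ∷ p₂ ∷ x ∷ m ∷ d ∷ e ∷ a ∷ []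

rt ro₁ ro₂ rp₁ rp₂ rx rm rd re ra : Fin 10
rt  = # 0
ro₁ = # 1
ro₂ = # 2
rp₁ = # 3
rp₂ = # 4
rx  = # 5
rm  = # 6
rd  = # 7
re  = # 8
ra  = # 9

double : Program 10
double = whileLE re rx ((rd ≔ reg re) ⨾ (re ≔ (rd ⊕ rd)))

-- Each round subtracts the largest 2 ^ k * m that is at most x.
reduce : Program 10
reduce = whileLE rm rx ((rd ≔ reg rm) ⨾ ((re ≔ (rd ⊕ rd)) ⨾ (double ⨾ (rx ≔ (rx ⊖ rd)))))

computeAge : Fin 10 → Fin 10 → Program 10
computeAge o p = (rx ≔ (rt ⊕ p)) ⨾ ((rx ≔ (rx ⊖ o)) ⨾ ((rm ≔ reg p) ⨾ reduce))

-- Register `rm` holds the age of δ₁ plus 1. As that age is below the period, the test `rp₁ ≤ rm`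
-- decides equality.
decideLast : Direction → Program 10
decideLast δ₁ =
  ifLE rp₁ rm
    (ifLE rx ra (rt ≔ const 0) (rt ≔ const (encodeAction (process (opposite δ₁)))))
    (rt ≔ const 0)

-- Registers `rd` and `re` now serve as the constants 0 and 1. The tests follow the constructors of
-- `Decision`; `decideLast` stands in two branches because the joint case takes two nested tests.
decide : Direction → Program 10
decide δ₁ =
  (rd ≔ const 0) ⨾ ((re ≔ const 1) ⨾ ((rm ≔ (ra ⊕ re)) ⨾
  ifLE ra rd (rt ≔ const (encodeAction (process δ₁)))
    (ifLE rx rd (rt ≔ const (encodeAction (process (opposite δ₁))))
      (ifLE ra re
        (ifLE rx re (rt ≔ const (encodeAction (process (opposite δ₁)))) (decideLast δ₁))
        (decideLast δ₁)))))

decideFromState : Direction → Program 10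
decideFromState δ₁ = computeAge ro₁ rp₁ ⨾ ((ra ≔ reg rx) ⨾ (computeAge ro₂ rp₂ ⨾ decide δ₁))

-- Puts the data of U first, so that `decideFromState` always finds δ₁ in the registers indexed 1.
swap : Program 10
swap = (rd ≔ reg ro₁) ⨾ ((ro₁ ≔ reg ro₂) ⨾ ((ro₂ ≔ reg rd) ⨾
       ((rd ≔ reg rp₁) ⨾ ((rp₁ ≔ reg rp₂) ⨾ (rp₂ ≔ reg rd)))))

scheduleFrom : Direction → Program 10
scheduleFrom D = decideFromState D
scheduleFrom U = swap ⨾ decideFromState U

periodRegister : Direction → Fin 10
periodRegister D = rp₁
periodRegister U = rp₂

schedule : Direction → Program 10
schedule tie = ifLE (periodRegister tie) (periodRegister (opposite tie))
  (scheduleFrom tie) (scheduleFrom (opposite tie))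

-- Correctness and running time of the program

module _ (k : ℕ) where

  private
    -- With `k` the input size, each input is below `2 ^ k`, each sum of `t` and a period below
    -- `2 ^ half`, and a double of such a number below `2 ^ suc half`; hence the bound `suc half` on
    -- operands.
    half = suc k

  open Bounded (suc half)

  *-double : ∀ e z → e * (2 * z) ≡ (e + e) * z
  *-double = ℕ-Solver.solve-∀

  half<⇒small : ∀ {n} → n < 2 ^ half → Small n
  half<⇒small n< = ≤-trans n< (m≤m+n _ _)

  double-small : ∀ {n} → n < 2 ^ half → Small (n + n)
  double-small {n} n< = ≤-trans (+-mono-< n< n<) (≤-reflexive (cong (λ x → 2 ^ half + x) (sym (+-identityʳ _))))

  -- The fuel `j` bounds the remaining doublings. A doubling takes one test and two assignments, and
  -- the final 1 is the failing test.
  double-spec : ∀ j {t o₁ o₂ p₁ p₂ x m d a} →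
    d ≤ x → x < 2 ^ half → m ∣ d → x < (d + d) * 2 ^ j →
    ∃[ d′ ] d′ ≤ x × x < d′ + d′ × m ∣ d′ ×
    Within double ⟪ t , o₁ , o₂ , p₁ , p₂ , x , m , d , d + d , a ⟫
                  ⟪ t , o₁ , o₂ , p₁ , p₂ , x , m , d′ , d′ + d′ , a ⟫ (3 * j + 1)
  double-spec j {x = x} {d = d} d≤x x< m∣d x<2^ with d + d ≤? x
  double-spec j {x = x} {d = d} d≤x x< m∣d x<2^ | no 2d≰x =
    d , d≤x , ≰⇒> 2d≰x , m∣d ,
    weaken (m≤n+m 1 (3 * j)) (while-false≤ (double-small (≤-<-trans d≤x x<) , half<⇒small x<) 2d≰x)
  double-spec zero {x = x} {d = d} d≤x x< m∣d x<2^ | yes 2d≤x =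
    contradiction 2d≤x (<⇒≱ (subst (x <_) (*-identityʳ (d + d)) x<2^))
  double-spec (suc j) {x = x} {d = d} d≤x x< m∣d x<2^ | yes 2d≤x
    with d′ , d′≤x , x<2d′ , m∣d′ , run ← double-spec j 2d≤x x< (∣m∣n⇒∣m+n m∣d m∣d)
           (subst (x <_) (*-double (d + d) (2 ^ j)) x<2^) =
    d′ , d′≤x , x<2d′ , m∣d′ ,
    weaken (≤-reflexive (count j))
      (while-true≤ (2d-small , half<⇒small x<) 2d≤x (step 2d-small then step (2d-small , 2d-small)) run)
    where
    2d-small : Small (d + d)
    2d-small = double-small (≤-<-trans d≤x x<)
    count : ∀ j → 3 + (3 * j + 1) ≡ 3 * suc j + 1
    count = ℕ-Solver.solve-∀

  <double-*-2^ : ∀ {x} m .{{_ : NonZero m}} → x < 2 ^ half → x < (m + m) * 2 ^ half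
  <double-*-2^ m x< = <-≤-trans x<
    (m≤n*m (2 ^ half) (m + m) {{>-nonZero (≤-trans (>-nonZero⁻¹ m) (m≤m+n m m))}})

  -- Subtracting the largest doubling removes more than half of `x`, so the number of rounds is at
  -- most linear in the bit length.
  ∸-halves : ∀ {x d} j → d ≤ x → x < d + d → x < 2 ^ suc j → x ∸ d < 2 ^ j
  ∸-halves {x} {d} j d≤x x<2d x<2^ = *-cancelˡ-< 2 _ _ (begin-strict
    2 * (x ∸ d)       ≡⟨ cong (λ y → (x ∸ d) + y) (+-identityʳ (x ∸ d)) ⟩
    (x ∸ d) + (x ∸ d) <⟨ +-monoʳ-< (x ∸ d) x∸d<d ⟩
    (x ∸ d) + d       ≡⟨ m∸n+n≡m d≤x ⟩
    x                 <⟨ x<2^ ⟩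
    2 * 2 ^ j         ∎)
    where
    open ≤-Reasoning
    x∸d<d : x ∸ d < d
    x∸d<d = +-cancelʳ-< d _ _ (subst (_< d + d) (sym (m∸n+n≡m d≤x)) x<2d)

  -- Here `j` bounds the rounds. A round costs `3 * half + 1` operations for the doublings and four
  -- more: the test, two initial assignments and the subtraction.
  reduce-spec : ∀ j {t o₁ o₂ p₁ p₂ x m d e a} .{{_ : NonZero m}} →
    x < 2 ^ j → x < 2 ^ half → m < 2 ^ half →
    ∃[ d′ ] ∃[ e′ ]
    Within reduce ⟪ t , o₁ , o₂ , p₁ , p₂ , x , m , d , e , a ⟫
                  ⟪ t , o₁ , o₂ , p₁ , p₂ , x % m , m , d′ , e′ , a ⟫ (j * (3 * half + 5) + 1)
  reduce-spec j {x = x} {m} {d} {e} x<2^j x< m< with m ≤? x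
  ... | no m≰x rewrite m<n⇒m%n≡m (≰⇒> m≰x) = d , e ,
    weaken (m≤n+m 1 _) (while-false≤ (half<⇒small m< , half<⇒small x<) m≰x)
  reduce-spec zero {m = m} (s≤s z≤n) _ _ | yes m≤0 = contradiction (n≤0⇒n≡0 m≤0) (≢-nonZero⁻¹ m)
  reduce-spec (suc j) {x = x} {m} x<2^j x< m< | yes m≤x
    -- Matching `refl` exposes the subtracted number as `q * m`, so the remainder modulo `m` is
    -- kept.
    with d′ , d′≤x , x<2d′ , divides q refl , run ← double-spec half m≤x x< ∣-refl (<double-*-2^ m x<)
    with d″ , e″ , run′ ← reduce-spec j {x = x ∸ q * m} {m} {d = q * m} {e = q * m + q * m}
           (∸-halves j d′≤x x<2d′ x<2^j) (≤-<-trans (m∸n≤m x (q * m)) x<) m<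
    rewrite m*n≤o⇒[o∸m*n]%n≡o%n q {m} {x} d′≤x =
    d″ , e″ ,
    weaken (≤-reflexive (count j half))
      (while-true≤ (half<⇒small m< , half<⇒small x<) m≤x
        (step (half<⇒small m<) then
         step (half<⇒small m< , half<⇒small m<) then
         run then
         step (half<⇒small x< , half<⇒small (≤-<-trans d′≤x x<)))
        run′)
    where
    count : ∀ j h → suc (1 + (1 + ((3 * h + 1) + 1))) + (j * (3 * h + 5) + 1) ≡ suc j * (3 * h + 5) + 1
    count = ℕ-Solver.solve-∀

  -- Only the first register carries the result, so the rest of the final state is hidden.
  Halts : ∀ {r} → Program (suc r) → State (suc r) → ℕ → ℕ → Set
  Halts p s h n = ∃[ s′ ] head s′ ≡ h × Within p s s′ n

  infixr 5 _thenₕ_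
  _thenₕ_ : ∀ {r} {p q : Program (suc r)} {s s′ h m n} →
            Within p s s′ m → Halts q s′ h n → Halts (p ⨾ q) s h (m + n)
  run thenₕ (s″ , eq , run′) = s″ , eq , run then run′

  if-trueₕ : ∀ {r x y} {p q : Program (suc r)} {s h n} → SmallOperands (x ⊕ y) s →
    lookup s x ≤ lookup s y → Halts p s h n → Halts (ifLE x y p q) s h (suc n)
  if-trueₕ a x≤y (s′ , eq , run) = s′ , eq , if-true≤ a x≤y run

  if-falseₕ : ∀ {r x y} {p q : Program (suc r)} {s h n} → SmallOperands (x ⊕ y) s →
    ¬ (lookup s x ≤ lookup s y) → Halts q s h n → Halts (ifLE x y p q) s h (suc n)
  if-falseₕ a x≰y (s′ , eq , run) = s′ , eq , if-false≤ a x≰y run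

  weakenₕ : ∀ {r} {p : Program (suc r)} {s h m n} → m ≤ n → Halts p s h m → Halts p s h n
  weakenₕ m≤n (s′ , eq , run) = s′ , eq , weaken m≤n run

  ≤2⇒small : ∀ {n} → n ≤ 2 → Small n
  ≤2⇒small n≤2 = ≤-<-trans n≤2 (<-≤-trans (s≤s (s≤s (s≤s z≤n))) (*-monoʳ-≤ 2 (*-monoʳ-≤ 2 (m^n>0 2 k))))

  encodeAction-small : ∀ α → Small (encodeAction α)
  encodeAction-small W           = ≤2⇒small z≤n
  encodeAction-small (process D) = ≤2⇒small (s≤s z≤n)
  encodeAction-small (process U) = ≤2⇒small ≤-refl

  reduce-operations : ℕ
  reduce-operations = half * (3 * half + 5) + 1

  -- Each stream has its own lemma because register updates compute only at concrete indices.
  computeAge₁-spec : ∀ {t o₁ o₂ p₁ p₂ x m d e a} .{{_ : NonZero p₁}} →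
    t + p₁ < 2 ^ half → o₁ ≤ p₁ →
    ∃[ d′ ] ∃[ e′ ]
    Within (computeAge ro₁ rp₁)
      ⟪ t , o₁ , o₂ , p₁ , p₂ , x , m , d , e , a ⟫
      ⟪ t , o₁ , o₂ , p₁ , p₂ , (t + p₁ ∸ o₁) % p₁ , p₁ , d′ , e′ , a ⟫
      (3 + reduce-operations)
  computeAge₁-spec {t} {o₁} {p₁ = p₁} t+p< o≤p =
    let d′ , e′ , run = reduce-spec half {x = t + p₁ ∸ o₁} {p₁} x< x< p< in
    d′ , e′ , (step (half<⇒small (≤-<-trans (m≤m+n t p₁) t+p<) , half<⇒small p<) then
               step (half<⇒small t+p< , half<⇒small (≤-<-trans o≤p p<)) then
               step (half<⇒small p<) then run)
    where
    p< = ≤-<-trans (m≤n+m p₁ t) t+p<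
    x< = ≤-<-trans (m∸n≤m (t + p₁) o₁) t+p<

  computeAge₂-spec : ∀ {t o₁ o₂ p₁ p₂ x m d e a} .{{_ : NonZero p₂}} →
    t + p₂ < 2 ^ half → o₂ ≤ p₂ →
    ∃[ d′ ] ∃[ e′ ]
    Within (computeAge ro₂ rp₂)
      ⟪ t , o₁ , o₂ , p₁ , p₂ , x , m , d , e , a ⟫
      ⟪ t , o₁ , o₂ , p₁ , p₂ , (t + p₂ ∸ o₂) % p₂ , p₂ , d′ , e′ , a ⟫
      (3 + reduce-operations)
  computeAge₂-spec {t} {o₂ = o₂} {p₂ = p₂} t+p< o≤p =
    let d′ , e′ , run = reduce-spec half {x = t + p₂ ∸ o₂} {p₂} x< x< p< in
    d′ , e′ , (step (half<⇒small (≤-<-trans (m≤m+n t p₂) t+p<) , half<⇒small p<) then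
               step (half<⇒small t+p< , half<⇒small (≤-<-trans o≤p p<)) then
               step (half<⇒small p<) then run)
    where
    p< = ≤-<-trans (m≤n+m p₂ t) t+p<
    x< = ≤-<-trans (m∸n≤m (t + p₂) o₂) t+p<

  answer : ∀ {t o₁ o₂ p₁ p₂ x m d e a} α →
    Halts (rt ≔ const (encodeAction α)) ⟪ t , o₁ , o₂ , p₁ , p₂ , x , m , d , e , a ⟫ (encodeAction α) 1
  answer α = _ , refl , step (encodeAction-small α)

  -- The 10 operations are three assignments and, on the longest path, six tests and the answer.
  decide-spec : ∀ {δ₁ t o₁ o₂ p₁ p₂ b m d e a α} →
    Decision δ₁ p₁ a b α → a < p₁ → p₁ < 2 ^ half → b < 2 ^ half →
    Halts (decide δ₁) ⟪ t , o₁ , o₂ , p₁ , p₂ , b , m , d , e , a ⟫ (encodeAction α) 10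
  decide-spec {δ₁} {t} {o₁} {o₂} {p₁} {p₂} {b} {a = a} {α} dec a<p p< b< =
    step 0-small thenₕ step 1-small thenₕ step (a-small , 1-small) thenₕ branches dec
    where
    0-small = ≤2⇒small {0} z≤n
    1-small = ≤2⇒small {1} (s≤s z≤n)
    a-small = half<⇒small (<-trans a<p p<)
    b-small = half<⇒small b<
    p-small = half<⇒small p<
    a+1-small : Small (a + 1)
    a+1-small = half<⇒small (≤-<-trans (≤-trans (≤-reflexive (+-comm a 1)) a<p) p<)

    s : State 10
    s = ⟪ t , o₁ , o₂ , p₁ , p₂ , b , a + 1 , 0 , 1 , a ⟫

    α₂ = process (opposite δ₁)

    last-reposition : suc a ≡ p₁ → a < b → Halts (decideLast δ₁) s (encodeAction α₂) 3
    last-reposition eq a<b =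
      if-trueₕ (p-small , a+1-small) (≤-reflexive (trans (sym eq) (+-comm 1 a)))
        (if-falseₕ (b-small , a-small) (<⇒≱ a<b) (answer α₂))

    last-idle : ¬ (suc a ≡ p₁ × a < b) → Halts (decideLast δ₁) s 0 3
    last-idle ¬reposition with p₁ ≤? a + 1
    ... | no p≰a+1 = weakenₕ (s≤s (s≤s z≤n)) (if-falseₕ (p-small , a+1-small) p≰a+1 (answer W))
    ... | yes p≤a+1 = if-trueₕ (p-small , a+1-small) p≤a+1
      (if-trueₕ (b-small , a-small)
        (≮⇒≥ λ a<b → ¬reposition (≤-antisym a<p (≤-trans p≤a+1 (≤-reflexive (+-comm a 1))) , a<b))
        (answer W))

    not-joint : ∀ {h q} → a ≢ 0 → b ≢ 0 → ¬ (a ≡ 1 × b ≡ 1) → Halts (decideLast δ₁) s h 3 →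
      Halts (ifLE ra re (ifLE rx re q (decideLast δ₁)) (decideLast δ₁)) s h 5
    not-joint a≢0 b≢0 ¬joint halts with a ≤? 1
    ... | no a≰1 = weakenₕ (n≤1+n 4) (if-falseₕ (a-small , 1-small) a≰1 halts)
    ... | yes a≤1 = if-trueₕ (a-small , 1-small) a≤1
      (if-falseₕ (b-small , 1-small)
        (λ b≤1 → ¬joint (≤-antisym a≤1 (n≢0⇒n>0 a≢0) , ≤-antisym b≤1 (n≢0⇒n>0 b≢0))) halts)

    branches : Decision δ₁ p₁ a b α → Halts _ s (encodeAction α) 7
    branches first = weakenₕ (m≤m+n 2 5) (if-trueₕ (a-small , 0-small) z≤n (answer (process δ₁)))
    branches arrival = weakenₕ (m≤m+n 3 4)
      (if-falseₕ (a-small , 0-small) (λ ())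
      (if-trueₕ (b-small , 0-small) z≤n (answer α₂)))
    branches joint = weakenₕ (m≤m+n 5 2)
      (if-falseₕ (a-small , 0-small) (λ ())
      (if-falseₕ (b-small , 0-small) (λ ())
      (if-trueₕ (a-small , 1-small) ≤-refl
      (if-trueₕ (b-small , 1-small) ≤-refl (answer α₂)))))
    branches (reposition eq a<b) =
      if-falseₕ (a-small , 0-small) (λ ())
      (if-falseₕ (b-small , 0-small) (λ ())
      (not-joint (λ ()) (λ ())
        (λ (a≡1 , b≡1) → <⇒≢ a<b (suc-injective (trans a≡1 (sym b≡1))))
        (last-reposition eq (s≤s a<b))))
    branches (idle ¬joint ¬reposition) =
      if-falseₕ (a-small , 0-small) (λ ())
      (if-falseₕ (b-small , 0-small) (λ ())
      (not-joint (λ ()) (λ ())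
        (λ (a≡1 , b≡1) → ¬joint (suc-injective a≡1 , suc-injective b≡1))
        (last-idle λ (eq , a<b) → ¬reposition (eq , s≤s⁻¹ a<b))))

  decideFromState-operations : ℕ
  decideFromState-operations = (3 + reduce-operations) + (1 + ((3 + reduce-operations) + 10))

  decideFromState-spec : ∀ {δ₁ t o₁ o₂ p₁ p₂ x m d e a α} .{{_ : NonZero p₁}} .{{_ : NonZero p₂}} →
    t + p₁ < 2 ^ half → o₁ ≤ p₁ → t + p₂ < 2 ^ half → o₂ ≤ p₂ →
    Decision δ₁ p₁ ((t + p₁ ∸ o₁) % p₁) ((t + p₂ ∸ o₂) % p₂) α →
    Halts (decideFromState δ₁) ⟪ t , o₁ , o₂ , p₁ , p₂ , x , m , d , e , a ⟫ (encodeAction α) decideFromState-operations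
  decideFromState-spec {t = t} {o₁} {o₂} {p₁} {p₂} t+p₁< o₁≤p₁ t+p₂< o₂≤p₂ dec
    with _ , _ , run₁ ← computeAge₁-spec {t} {o₁} {o₂} {p₁} {p₂} t+p₁< o₁≤p₁
    with _ , _ , run₂ ← computeAge₂-spec {t} {o₁} {o₂} {p₁} {p₂} t+p₂< o₂≤p₂ =
    run₁ thenₕ step (half<⇒small (<-trans a<p₁ p₁<)) thenₕ run₂ thenₕ
    decide-spec dec a<p₁ p₁< (<-trans (m%n<n (t + p₂ ∸ o₂) p₂) (≤-<-trans (m≤n+m p₂ t) t+p₂<))
    where
    a<p₁ = m%n<n (t + p₁ ∸ o₁) p₁
    p₁<  = ≤-<-trans (m≤n+m p₁ t) t+p₁<

  initial : TwoStreams → ℕ → State 10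
  initial I t = ⟪ t , offset (timing I D) , offset (timing I U)
                , period (timing I D) , period (timing I U) , 0 , 0 , 0 , 0 , 0 ⟫

  module _ (I : TwoStreams) (t : ℕ) (t+period< : ∀ δ → t + period (timing I δ) < 2 ^ half) where

    private
      instance
        period-nonZero : ∀ {δ} → NonZero (period (timing I δ))
        period-nonZero {δ} = >-nonZero (<⇒≤ (2≤period I δ))

    decision-% : ∀ δ₁ → let s₁ = timing I δ₁; s₂ = timing I (opposite δ₁) in
      Decision δ₁ (period s₁) ((t + period s₁ ∸ offset s₁) % period s₁)
                              ((t + period s₂ ∸ offset s₂) % period s₂) (σ* I δ₁ t)
    decision-% δ₁ = subst₂ (λ a b → Decision δ₁ (period (timing I δ₁)) a b (σ* I δ₁ t))
      (age-% (timing I δ₁) t) (age-% (timing I (opposite δ₁)) t) (decision I δ₁ t)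

    period-small : ∀ δ → Small (period (timing I δ))
    period-small δ = half<⇒small (≤-<-trans (m≤n+m _ t) (t+period< δ))

    offset-small : ∀ δ → Small (offset (timing I δ))
    offset-small δ = ≤-<-trans (offset≤period (timing I δ)) (period-small δ)

    -- The 6 pays for the assignments of `swap`; the case D is padded to the same bound.
    scheduleFrom-spec : ∀ δ₁ →
      Halts (scheduleFrom δ₁) (initial I t) (encodeAction (σ* I δ₁ t)) (6 + decideFromState-operations)
    scheduleFrom-spec D = weakenₕ (m≤n+m _ 6)
      (decideFromState-spec (t+period< D) (offset≤period (timing I D)) (t+period< U) (offset≤period (timing I U))
        (decision-% D))
    scheduleFrom-spec U =
      (step (offset-small D) then step (offset-small U) then step (offset-small D) then
       step (period-small D) then step (period-small U) then step (period-small D)) thenₕ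
      decideFromState-spec (t+period< U) (offset≤period (timing I U)) (t+period< D) (offset≤period (timing I D))
        (decision-% U)

    periodRegister-spec : ∀ δ → lookup (initial I t) (periodRegister δ) ≡ period (timing I δ)
    periodRegister-spec D = refl
    periodRegister-spec U = refl

    schedule-spec : ∀ tie →
      Halts (schedule tie) (initial I t) (encodeAction (σ* I (shorter tie I) t)) (7 + decideFromState-operations)
    schedule-spec tie =
      if-does-elim (λ δ → Halts (schedule tie) (initial I t) (encodeAction (σ* I δ t)) (7 + decideFromState-operations))
        (period (timing I tie) ≤? period (timing I (opposite tie)))
        (λ p≤p′ → if-trueₕ operands (subst₂ _≤_ (sym eq) (sym eq′) p≤p′) (scheduleFrom-spec tie))
        (λ p≰p′ → if-falseₕ operands (p≰p′ ∘ subst₂ _≤_ eq eq′) (scheduleFrom-spec (opposite tie)))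
      where
      eq  = periodRegister-spec tie
      eq′ = periodRegister-spec (opposite tie)
      operands = subst Small (sym eq) (period-small tie) , subst Small (sym eq′) (period-small (opposite tie))

-- The summand added to the left-hand side is the difference of the two sides,
-- written in terms of k - 1 so that its coefficients are positive.
cost-bound : ∀ k → .{{NonZero k}} →
  (7 + decideFromState-operations k) * (suc (2 + k) + suc (2 + k)) ≤ 560 * k ^ 3
cost-bound (suc k) = ≤-trans
  (m≤m+n ((7 + decideFromState-operations (suc k)) * (suc (3 + k) + suc (3 + k)))
         (548 * (k * k * k) + 1564 * (k * k) + 1268 * k))
  (≤-reflexive (expand k))
  where
  expand : ∀ k → let h = 2 + k; r = h * (3 * h + 5) + 1 in
    (7 + ((3 + r) + (1 + ((3 + r) + 10)))) * (suc (1 + h) + suc (1 + h))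
      + (548 * (k * k * k) + 1564 * (k * k) + 1268 * k)
    ≡ 560 * (suc k * (suc k * (suc k * 1)))
  expand = ℕ-Solver.solve-∀

∈-size : ∀ {n} (v : Vec ℕ n) i → bitLength (lookup v i) ≤ size v
∈-size (x ∷ v) zero    = m≤m+n (bitLength x) (size v)
∈-size (x ∷ v) (suc i) = m≤n⇒m≤o+n (bitLength x) (∈-size v i)

lookup<2^size : ∀ {n} (v : Vec ℕ n) i → lookup v i < 2 ^ size v
lookup<2^size v i = <-≤-trans (n<2^bitLength (lookup v i)) (^-monoʳ-≤ 2 (∈-size v i))

σ*-polynomialTime : (tie : Direction) →
  PolynomialTime encodeQuery (λ q → encodeAction (σ*-at tie q))
σ*-polynomialTime tie = 5 , schedule tie , 560 , 3 , halts
  where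
  halts : ∀ q → _
  halts q@(I , t , _) =
    let s , eq , Bounded.within run c≤ = schedule-spec (size (encodeQuery q)) I t t+p< tie in
    s , _ , run , eq , ≤-trans c≤ (cost-bound (size (encodeQuery q)))
    where
    t+p< : ∀ δ → t + period (timing I δ) < 2 ^ suc (size (encodeQuery q))
    t+p< δ = <-≤-trans (+-mono-< (lookup<2^size (encodeQuery q) (# 0)) (period< δ))
      (≤-reflexive (cong (λ x → 2 ^ size (encodeQuery q) + x) (sym (+-identityʳ _))))
      where
      period< : ∀ δ → period (timing I δ) < 2 ^ size (encodeQuery q)
      period< D = lookup<2^size (encodeQuery q) (# 3)
      period< U = lookup<2^size (encodeQuery q) (# 4)

theorem2 : ((I : TwoStreams) (δ₁ : Direction) →
    period (timing I δ₁) ≤ period (timing I (opposite δ₁)) →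
    Optimal (streams I) (σ* I δ₁))
    ×
    ((tie : Direction) →
    PolynomialTime encodeQuery (λ q → encodeAction (σ*-at tie q)))
theorem2 = σ*-optimal , σ*-polynomialTime
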